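{- There is an $O(n^4)$ time algorithm that, given a UFPP instance with $n$ tasks, computes a maximum profit independent task set (ITS) for the instance.
   Context: UFPP (Unsplittable Flow Problem on a Path) instance: a path $P=(V,E)$ with $V=\{0,\ldots,m\}$, $E=\{\{i,i+1\}\mid 0\le i\le m-1\}$, a positive integer capacity $u_e$ for each edge $e\in E$, and a set $T=\{1,\ldots,n\}$ of tasks, where task $i$ has a start vertex $s_i\in V$ and end vertex $t_i\in V$ with $s_i<t_i$, a positive integer demand $d_i$, and a positive integer profit $w_i$. Task $i$ uses edge $e$ if $e$ lies on the subpath from $s_i$ to $t_i$. It is assumed that every vertex of $P$ is a start or end vertex of some task, so $m<2n$. It is also assumed that $d_i\le b(i)$ for every task (so each task is feasible by itself), where the bottleneck capacity $b(i)$ is the minimum of $u_e$ over all edges $e$ used by $i$. Let $\ell(i)=b(i)-d_i$, a non-negative integer. $(x_1,y_1,x_2,y_2)$ denotes the axis-parallel rectangle in $\mathbb R^2$ with upper left point $(x_1,y_1)$ and lower right point $(x_2,y_2)$. The rectangle associated with task $i$ is $(s_i,b(i),t_i,\ell(i))$. Two rectangles $(x_1,y_1,x_2,y_2)$ and $(x'_1,y'_1,x'_2,y'_2)$ are compatible if they share no internal point, i.e. at least one of $x_2\le x'_1$, $x'_2\le x_1$, $y_1\le y'_2$, $y'_1\le y_2$ holds. Two tasks are compatible if their associated rectangles are. An independent task set (ITS) is a set $F\subseteq T$ of pairwise compatible tasks; its profit is $\sum_{i\in F}w_i$. -}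

module Defs where

open import Data.Bool using (Bool; true; false; if_then_else_) renaming (not to notᵇ; _∧_ to _∧ᵇ_; _∨_ to _∨ᵇ_)
open import Data.Fin using (Fin; toℕ; fromℕ<)
open import Data.Fin.Properties using (toℕ≤pred[n])
open import Data.Fin.Subset using (Subset; _∈_)
open import Data.Fin.Subset.Properties using (_∈?_)
open import Data.List using (List; map; filter; allFin)
open import Data.List.Extrema.Nat using (min)
open import Data.Nat using (ℕ; suc; _+_; _∸_; _≤_; _<_; _≤?_; _<?_; _<ᵇ_; _≡ᵇ_)
open import Data.Nat.ListAction using (sum)
open import Data.Nat.Properties using (<-≤-trans)
open import Data.Product using (_×_; ∃)
open import Data.Sum using (_⊎_)
open import Data.Vec using (tabulate)
open import Relation.Binary.PropositionalEquality using (_≡_; _≢_)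
open import Relation.Nullary using (Dec; yes; no)
open import Relation.Nullary.Decidable using (_×-dec_)

-- Vertices are Fin (suc m), tasks are Fin n (numbered from 0), and
-- e : Fin m stands for the edge {e , e + 1}.
record UFPP (m n : ℕ) : Set where
  field
    u     : Fin m → ℕ
    s t   : Fin n → Fin (suc m)
    d w   : Fin n → ℕ
    0<u   : ∀ e → 0 < u e
    0<d   : ∀ i → 0 < d i
    0<w   : ∀ i → 0 < w i
    s<t   : ∀ i → toℕ (s i) < toℕ (t i)
    cover : ∀ v → ∃ λ i → v ≡ s i ⊎ v ≡ t i

  Uses : Fin n → Fin m → Set
  Uses i e = toℕ (s i) ≤ toℕ e × toℕ e < toℕ (t i)

  uses? : ∀ i e → Dec (Uses i e)
  uses? i e = (toℕ (s i) ≤? toℕ e) ×-dec (toℕ e <? toℕ (t i))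

  usedEdges : Fin n → List (Fin m)
  usedEdges i = filter (uses? i) (allFin m)

  firstEdge : Fin n → Fin m
  firstEdge i = fromℕ< (<-≤-trans (s<t i) (toℕ≤pred[n] (t i)))

  -- min takes a default element; the first edge of the task is itself one
  -- of the used edges, so the default does not affect the minimum.
  b : Fin n → ℕ
  b i = min (u (firstEdge i)) (map u (usedEdges i))

  field
    d≤b : ∀ i → d i ≤ b i

  ℓ : Fin n → ℕ
  ℓ i = b i ∸ d i

-- Upper left corner (x₁ , y₁), lower right corner (x₂ , y₂); all rectangles
-- that occur have natural number coordinates.
record Rectangle : Set where
  constructor rect
  field
    x₁ y₁ x₂ y₂ : ℕ

CompatibleRect : Rectangle → Rectangle → Set
CompatibleRect (rect x₁ y₁ x₂ y₂) (rect x₁′ y₁′ x₂′ y₂′) =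
  x₂ ≤ x₁′ ⊎ x₂′ ≤ x₁ ⊎ y₁ ≤ y₂′ ⊎ y₁′ ≤ y₂

module _ {m n : ℕ} (I : UFPP m n) where
  open UFPP I

  rectangle : Fin n → Rectangle
  rectangle i = rect (toℕ (s i)) (b i) (toℕ (t i)) (ℓ i)

  Compatible : Fin n → Fin n → Set
  Compatible i j = CompatibleRect (rectangle i) (rectangle j)

  IsITS : Subset n → Set
  IsITS F = ∀ i j → i ∈ F → j ∈ F → i ≢ j → Compatible i j

  profit : Subset n → ℕ
  profit F = sum (map w (filter (_∈? F) (allFin n)))

  IsMaximumITS : Subset n → Set
  IsMaximumITS F = IsITS F × (∀ G → IsITS G → profit G ≤ profit F)

-- Algorithms are structured programs for a unit-cost random access machine.
-- The machine has registers and arrays holding natural numbers.  Its only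
-- arithmetic is addition and truncated subtraction (multiplication at unit
-- cost would make the model unreasonably powerful).  A program is a finite
-- piece of syntax, hence mentions finitely many registers, arrays and
-- constants, independently of the input.

Reg Arr : Set
Reg = ℕ
Arr = ℕ

infixl 6 _⊕_ _⊖_
infix  7 _‼_
infix  5 _≺_ _≈_
infixr 4 _and_
infixr 3 _or_
infix  2 _≔_ _[_]≔_
infixr 1 _⨾_

data Exp : Set where
  lit     : ℕ → Exp
  reg     : Reg → Exp
  _‼_     : Arr → Exp → Exp
  _⊕_ _⊖_ : Exp → Exp → Exp

data Test : Set where
  _≺_ _≈_    : Exp → Exp → Test
  not        : Test → Test
  _and_ _or_ : Test → Test → Test

data Prog : Set where
  skip           : Prog
  _≔_            : Reg → Exp → Prog
  _[_]≔_         : Arr → Exp → Exp → Prog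
  _⨾_            : Prog → Prog → Prog
  IF_THEN_ELSE_  : Test → Prog → Prog → Prog
  WHILE_DO_      : Test → Prog → Prog

record State : Set where
  constructor state
  field
    regs : Reg → ℕ
    arrs : Arr → ℕ → ℕ
open State public

update : {A : Set} → (ℕ → A) → ℕ → A → ℕ → A
update f k a j = if j ≡ᵇ k then a else f j

setReg : Reg → ℕ → State → State
setReg x a (state ρ μ) = state (update ρ x a) μ

setArr : Arr → ℕ → ℕ → State → State
setArr A k a (state ρ μ) = state ρ (update μ A (update (μ A) k a))

⟦_⟧ : Exp → State → ℕ
⟦ lit k ⟧   σ = k
⟦ reg x ⟧   σ = regs σ x
⟦ A ‼ e ⟧   σ = arrs σ A (⟦ e ⟧ σ)
⟦ e ⊕ f ⟧   σ = ⟦ e ⟧ σ + ⟦ f ⟧ σ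
⟦ e ⊖ f ⟧   σ = ⟦ e ⟧ σ ∸ ⟦ f ⟧ σ

⟦_⟧ᵗ : Test → State → Bool
⟦ e ≺ f ⟧ᵗ   σ = ⟦ e ⟧ σ <ᵇ ⟦ f ⟧ σ
⟦ e ≈ f ⟧ᵗ   σ = ⟦ e ⟧ σ ≡ᵇ ⟦ f ⟧ σ
⟦ not p ⟧ᵗ   σ = notᵇ (⟦ p ⟧ᵗ σ)
⟦ p and q ⟧ᵗ σ = ⟦ p ⟧ᵗ σ ∧ᵇ ⟦ q ⟧ᵗ σ
⟦ p or q ⟧ᵗ  σ = ⟦ p ⟧ᵗ σ ∨ᵇ ⟦ q ⟧ᵗ σ

cost : Exp → ℕ
cost (lit k)   = 1
cost (reg x)   = 1
cost (A ‼ e)   = suc (cost e)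
cost (e ⊕ f)   = suc (cost e + cost f)
cost (e ⊖ f)   = suc (cost e + cost f)

costᵗ : Test → ℕ
costᵗ (e ≺ f)   = suc (cost e + cost f)
costᵗ (e ≈ f)   = suc (cost e + cost f)
costᵗ (not p)   = suc (costᵗ p)
costᵗ (p and q) = suc (costᵗ p + costᵗ q)
costᵗ (p or q)  = suc (costᵗ p + costᵗ q)

-- ⟨ p , σ ⟩⇓⟨ σ′ , k ⟩ : started in σ, p halts in σ′ after k steps.
-- Executions are finite derivations, so a diverging p has none.
infix 4 ⟨_,_⟩⇓⟨_,_⟩

data ⟨_,_⟩⇓⟨_,_⟩ : Prog → State → State → ℕ → Set where
  ⇓skip : ∀ {σ} → ⟨ skip , σ ⟩⇓⟨ σ , 1 ⟩
  ⇓reg  : ∀ {x e σ} →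
          ⟨ x ≔ e , σ ⟩⇓⟨ setReg x (⟦ e ⟧ σ) σ , suc (cost e) ⟩
  ⇓arr  : ∀ {A e f σ} →
          ⟨ A [ e ]≔ f , σ ⟩⇓⟨ setArr A (⟦ e ⟧ σ) (⟦ f ⟧ σ) σ , suc (cost e + cost f) ⟩
  ⇓seq  : ∀ {p q σ σ′ σ″ k l} →
          ⟨ p , σ ⟩⇓⟨ σ′ , k ⟩ → ⟨ q , σ′ ⟩⇓⟨ σ″ , l ⟩ →
          ⟨ p ⨾ q , σ ⟩⇓⟨ σ″ , k + l ⟩
  ⇓then : ∀ {c p q σ σ′ k} → ⟦ c ⟧ᵗ σ ≡ true →
          ⟨ p , σ ⟩⇓⟨ σ′ , k ⟩ →
          ⟨ IF c THEN p ELSE q , σ ⟩⇓⟨ σ′ , suc (costᵗ c + k) ⟩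
  ⇓else : ∀ {c p q σ σ′ k} → ⟦ c ⟧ᵗ σ ≡ false →
          ⟨ q , σ ⟩⇓⟨ σ′ , k ⟩ →
          ⟨ IF c THEN p ELSE q , σ ⟩⇓⟨ σ′ , suc (costᵗ c + k) ⟩
  ⇓exit : ∀ {c p σ} → ⟦ c ⟧ᵗ σ ≡ false →
          ⟨ WHILE c DO p , σ ⟩⇓⟨ σ , suc (costᵗ c) ⟩
  ⇓loop : ∀ {c p σ σ′ σ″ k l} → ⟦ c ⟧ᵗ σ ≡ true →
          ⟨ p , σ ⟩⇓⟨ σ′ , k ⟩ → ⟨ WHILE c DO p , σ′ ⟩⇓⟨ σ″ , l ⟩ →
          ⟨ WHILE c DO p , σ ⟩⇓⟨ σ″ , suc (costᵗ c + (k + l)) ⟩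

fromFin : ∀ {k} → (Fin k → ℕ) → ℕ → ℕ
fromFin {k} f j with j <? k
... | yes j<k = f (fromℕ< j<k)
... | no  _   = 0

-- The input is n and m in registers 0 and 1, and u, s, t, d, w in arrays
-- 0 to 4; every other register and array cell is initially 0.
input : ∀ {m n} → UFPP m n → State
input {m} {n} I = state ρ μ
  where
  open UFPP I

  ρ : Reg → ℕ
  ρ 0 = n
  ρ 1 = m
  ρ _ = 0

  μ : Arr → ℕ → ℕ
  μ 0 = fromFin u
  μ 1 = fromFin (λ i → toℕ (s i))
  μ 2 = fromFin (λ i → toℕ (t i))
  μ 3 = fromFin d
  μ 4 = fromFin w
  μ _ = λ _ → 0

-- The output is the set of tasks i with a nonzero entry in cell i of array 5.
output : ∀ n → State → Subset n
output n σ = tabulate (λ i → 0 <ᵇ arrs σ 5 (toℕ i))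

{-# OPTIONS --safe #-}

-- Let e k be an edge at which task k attains its bottleneck capacity.  In an
-- independent set F, let k have the lowest bottom side ℓ k.  Another task of F
-- that used e k would have its rectangle start at height at most b k and end
-- no lower than ℓ k, hence would overlap k; so every other task lies on one
-- side of e k.  A task j to the left ends before k starts or has ℓ j ≥ b k,
-- symmetrically on the right, and tasks on different sides never interact.
-- Hence the tasks that fit between two anchors A and C (tasks already chosen,
-- or a sentinel bounding the path) have optimum
--   Opt A C = max (0 , max { Opt A k + Opt k C + w k | k fits between A and C }).
-- The path between the bottleneck edges of the anchors shrinks along this
-- recursion, so after r sweeps that recompute all n² pairs in place, all pairs
-- whose path has fewer than r edges are solved.  As m + 1 ≤ 2n sweeps suffice
-- and a pair takes time O(n), the total time is O(n⁴).

module Submission where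

open import Defs
open import Algebra.Properties.CommutativeMonoid.Sum using ()
open import Data.Bool using (Bool; true; false; if_then_else_; T) renaming (not to notᵇ; _∧_ to _∧ᵇ_; _∨_ to _∨ᵇ_)
open import Data.Bool.Properties using (T-∧; T-∨; T-≡; T-not-≡)
open import Data.Fin as Fin using (Fin; zero; suc; toℕ; fromℕ<)
open import Data.Fin.Properties using (toℕ<n; toℕ-fromℕ<; fromℕ<-toℕ; toℕ≤pred[n]; toℕ-injective; splitAt-join; injective⇒≤)
open import Data.Fin.Subset using (Subset; _∈_)
open import Data.Fin.Subset.Properties using (_∈?_)
open import Data.List as List using (filter; allFin)
open import Data.List.Extrema.Nat using (min≤v⁺; v≤min⁺)
open import Data.List.Membership.Propositional using (lose)
open import Data.List.Membership.Propositional.Properties using (∈-filter⁺; ∈-filter⁻; ∈-allFin)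
open import Data.List.Relation.Unary.All as All using ()
open import Data.List.Relation.Unary.All.Properties as All using ()
open import Data.List.Relation.Unary.Any.Properties as Any using ()
open import Data.Nat using (ℕ; zero; suc; _+_; _*_; _^_; _∸_; _⊔_; _≤_; _<_; _<ᵇ_; _≡ᵇ_; _≟_; _≤?_; _<?_; z≤n; s≤s; NonZero; >-nonZero)
open import Data.Nat.ListAction as ListAction using ()
open import Data.Nat.Properties
open import Data.Nat.Solver using (module +-*-Solver)
open import Data.Product using (_×_; _,_; Σ-syntax; ∃-syntax; proj₁; proj₂)
open import Data.Sum using (_⊎_; inj₁; inj₂; [_,_])
open import Data.Vec.Properties using ([]=⇒lookup; lookup⇒[]=; lookup∘tabulate)
open import Function using (_∘_; id; Equivalence)
open import Relation.Binary.Definitions using (tri<; tri≈; tri>)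
open import Relation.Binary.PropositionalEquality using (_≡_; _≢_; refl; sym; trans; cong; cong₂; subst; subst₂)
open import Relation.Nullary using (¬_; Dec; yes; no; does; contradiction)
open import Relation.Unary using (Decidable)
open Algebra.Properties.CommutativeMonoid.Sum +-0-commutativeMonoid using (sum; sum-cong-≗; ∑-distrib-+)

-- Programs with bounded loops, their semantics and running time

infix  2 _←_ _[_]←_
infixr 1 _⨟_
infix  0 If_Then_Else_ For_Below_Do_

-- No ordering of the pairs by the length of their path is ever computed: a sweep visits them in a
-- fixed order, whatever the cells contain. Overwriting is harmless because an entry is trusted only
-- once its path is short enough, and its value then depends only on entries with strictly shorter
-- paths. The price is a factor `m + 1`, which still fits into the bound. Each pair stores its
-- solution as a full 0/1 vector. Copying two vectors takes as long as searching for the best task,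
-- so this is free up to a constant and spares a traceback, which would need a stack. To separate
-- correctness from time, programs are written in a language whose loops run a number of times fixed
-- on entry. It has a total function `run` as semantics, so correctness is a matter of equations and
-- loop invariants, while the time can be read off the syntax: all limits are at most `2 * n`, so
-- the nesting depth is the exponent.

data Code : Set where
  nop            : Code
  _←_            : Reg → Exp → Code
  _[_]←_         : Arr → Exp → Exp → Code
  _⨟_            : Code → Code → Code
  If_Then_Else_  : Test → Code → Code → Code
  For_Below_Do_  : Reg → Reg → Code → Code

step : Reg → Code → Prog

compile : Code → Prog
compile nop                   = skip
compile (x ← e)               = x ≔ e
compile (A [ e ]← f)          = A [ e ]≔ f
compile (c ⨟ c′)              = compile c ⨾ compile c′
compile (If p Then c Else c′)   = IF p THEN compile c ELSE compile c′
compile (For i Below l Do c)  = i ≔ lit 0 ⨾ WHILE reg i ≺ reg l DO step i c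

step i c = compile c ⨾ i ≔ reg i ⊕ lit 1

iterations : ℕ → (State → State) → State → State
iterations zero    f σ = σ
iterations (suc j) f σ = f (iterations j f σ)

increment : Reg → State → State
increment i σ = setReg i (regs σ i + 1) σ

run : Code → State → State
run nop                  σ = σ
run (x ← e)              σ = setReg x (⟦ e ⟧ σ) σ
run (A [ e ]← f)         σ = setArr A (⟦ e ⟧ σ) (⟦ f ⟧ σ) σ
run (c ⨟ c′)             σ = run c′ (run c σ)
run (If p Then c Else c′)  σ = if ⟦ p ⟧ᵗ σ then run c σ else run c′ σ
run (For i Below l Do c) σ = iterations (regs σ l) (increment i ∘ run c) (setReg i 0 σ)

-- Boolean-valued, so that for a concrete program the claim that a register survives is closed by
-- `refl`.
writesReg : Code → Reg → Bool
writesReg nop                  y = false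
writesReg (x ← e)              y = y ≡ᵇ x
writesReg (A [ e ]← f)         y = false
writesReg (c ⨟ c′)             y = writesReg c y ∨ᵇ writesReg c′ y
writesReg (If p Then c Else c′)  y = writesReg c y ∨ᵇ writesReg c′ y
writesReg (For i Below l Do c) y = (y ≡ᵇ i) ∨ᵇ writesReg c y

writesArr : Code → Arr → Bool
writesArr nop                  B = false
writesArr (x ← e)              B = false
writesArr (A [ e ]← f)         B = B ≡ᵇ A
writesArr (c ⨟ c′)             B = writesArr c B ∨ᵇ writesArr c′ B
writesArr (If p Then c Else c′)  B = writesArr c B ∨ᵇ writesArr c′ B
writesArr (For i Below l Do c) B = writesArr c B

-- Registers 0 to 3 are reserved for loop limits and never assigned, so the
-- number of iterations of every loop is known beforehand.
ok : Code → Bool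
ok nop                  = true
ok (x ← e)              = notᵇ (x <ᵇ 4)
ok (A [ e ]← f)         = true
ok (c ⨟ c′)             = ok c ∧ᵇ ok c′
ok (If p Then c Else c′)  = ok c ∧ᵇ ok c′
ok (For i Below l Do c) = notᵇ (i <ᵇ 4) ∧ᵇ (l <ᵇ 4) ∧ᵇ notᵇ (writesReg c i) ∧ᵇ ok c

-- What a program leaves unchanged

∨-false : ∀ {a b} → (a ∨ᵇ b) ≡ false → a ≡ false × b ≡ false
∨-false {false} {false} refl = refl , refl

∧-T : ∀ {a b} → T (a ∧ᵇ b) → T a × T b
∧-T = Equivalence.to T-∧

not-T : ∀ {a} → T (notᵇ a) → a ≡ false
not-T = Equivalence.to T-not-≡

update-≡ : ∀ {A : Set} (f : ℕ → A) k a → update f k a k ≡ a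
update-≡ f k a rewrite Equivalence.to T-≡ (≡⇒≡ᵇ k k refl) = refl

update-≢ : ∀ {A : Set} (f : ℕ → A) {k} a {j} → j ≢ k → update f k a j ≡ f j
update-≢ f {k} a {j} j≢k with j ≡ᵇ k in eq
... | true  = contradiction (≡ᵇ⇒≡ j k (Equivalence.from T-≡ eq)) j≢k
... | false = refl

update-false : ∀ {A : Set} (f : ℕ → A) k a j → (j ≡ᵇ k) ≡ false → update f k a j ≡ f j
update-false f k a j eq rewrite eq = refl

regs-run : ∀ c {x} σ → writesReg c x ≡ false → regs (run c σ) x ≡ regs σ x

regs-iterations : ∀ i c {x} σ k → (x ≡ᵇ i) ≡ false → writesReg c x ≡ false →
                  regs (iterations k (increment i ∘ run c) σ) x ≡ regs σ x
regs-iterations i c σ zero    x≢i w = refl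
regs-iterations i c σ (suc k) x≢i w =
  trans (update-false (regs (run c (iterations k (increment i ∘ run c) σ))) i _ _ x≢i) (trans (regs-run c _ w) (regs-iterations i c σ k x≢i w))

regs-run nop                    σ w = refl
regs-run (x ← e)                σ w = update-false (regs σ) x _ _ w
regs-run (A [ e ]← f)           σ w = refl
regs-run (c ⨟ c′)               σ w with w₁ , w₂ ← ∨-false w =
  trans (regs-run c′ _ w₂) (regs-run c σ w₁)
regs-run (If p Then c Else c′)    σ w with ⟦ p ⟧ᵗ σ | ∨-false w
... | true  | w₁ , _  = regs-run c σ w₁
... | false | _  , w₂ = regs-run c′ σ w₂
regs-run (For i Below l Do c)   σ w with w₁ , w₂ ← ∨-false w =
  trans (regs-iterations i c _ (regs σ l) w₁ w₂) (update-false (regs σ) i 0 _ w₁)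

arrs-run : ∀ c {B} σ → writesArr c B ≡ false → arrs (run c σ) B ≡ arrs σ B

arrs-iterations : ∀ i c {B} σ k → writesArr c B ≡ false →
                  arrs (iterations k (increment i ∘ run c) σ) B ≡ arrs σ B
arrs-iterations i c σ zero    w = refl
arrs-iterations i c σ (suc k) w = trans (arrs-run c _ w) (arrs-iterations i c σ k w)

arrs-run nop                    σ w = refl
arrs-run (x ← e)                σ w = refl
arrs-run (A [ e ]← f)           σ w = update-false (arrs σ) A _ _ w
arrs-run (c ⨟ c′)               σ w with w₁ , w₂ ← ∨-false w =
  trans (arrs-run c′ _ w₂) (arrs-run c σ w₁)
arrs-run (If p Then c Else c′)    σ w with ⟦ p ⟧ᵗ σ | ∨-false w
... | true  | w₁ , _  = arrs-run c σ w₁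
... | false | _  , w₂ = arrs-run c′ σ w₂
arrs-run (For i Below l Do c)   σ w = arrs-iterations i c _ (regs σ l) w

limit≢ : ∀ {x y} → x < 4 → T (notᵇ (y <ᵇ 4)) → (x ≡ᵇ y) ≡ false
limit≢ {x} {y} x<4 y≮4 with x ≡ᵇ y in eq
... | false = refl
... | true with refl ← ≡ᵇ⇒≡ x y (Equivalence.from T-≡ eq) =
  contradiction (trans (sym (Equivalence.to T-≡ (<⇒<ᵇ x<4))) (not-T y≮4)) λ ()

limit-kept : ∀ c {x} → T (ok c) → x < 4 → writesReg c x ≡ false
limit-kept nop                  o x<4 = refl
limit-kept (x ← e)              o x<4 = limit≢ x<4 o
limit-kept (A [ e ]← f)         o x<4 = refl
limit-kept (c ⨟ c′)             o x<4 with o₁ , o₂ ← ∧-T {ok c} o =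
  cong₂ _∨ᵇ_ (limit-kept c o₁ x<4) (limit-kept c′ o₂ x<4)
limit-kept (If p Then c Else c′)  o x<4 with o₁ , o₂ ← ∧-T {ok c} o =
  cong₂ _∨ᵇ_ (limit-kept c o₁ x<4) (limit-kept c′ o₂ x<4)
limit-kept (For i Below l Do c) o x<4 with o₁ , o′ ← ∧-T {notᵇ (i <ᵇ 4)} o
  with _ , o″ ← ∧-T {l <ᵇ 4} o′ with _ , o₄ ← ∧-T {notᵇ (writesReg c i)} o″ =
  cong₂ _∨ᵇ_ (limit≢ x<4 o₁) (limit-kept c o₄ x<4)

-- Running time from the nesting depth of loops

degree : Code → ℕ
degree nop                  = 0
degree (x ← e)              = 0
degree (A [ e ]← f)         = 0
degree (c ⨟ c′)             = degree c ⊔ degree c′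
degree (If p Then c Else c′)  = degree c ⊔ degree c′
degree (For i Below l Do c) = suc (degree c)

coeff : Code → ℕ
coeff nop                  = 1
coeff (x ← e)              = suc (cost e)
coeff (A [ e ]← f)         = suc (cost e + cost f)
coeff (c ⨟ c′)             = coeff c + coeff c′
coeff (If p Then c Else c′)  = suc (costᵗ p + (coeff c + coeff c′))
-- A loop pays 2 for the initial assignment and 4 for the failing test, and every round pays 4 for
-- its test and 4 for the increment: 14 = 6 + 8.
coeff (For i Below l Do c) = coeff c + 14

Bounded : ℕ → State → Set
Bounded X σ = ∀ {l} → l < 4 → regs σ l ≤ X

bounded-run : ∀ c {X σ} → T (ok c) → Bounded X σ → Bounded X (run c σ)
bounded-run c {σ = σ} o bd l<4 = subst (_≤ _) (sym (regs-run c σ (limit-kept c o l<4))) (bd l<4)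

module _ {X : ℕ} (1≤X : 1 ≤ X) where

  private instance
    X≢0 : NonZero X
    X≢0 = >-nonZero 1≤X

  1≤pow : ∀ e → 1 ≤ X ^ e
  1≤pow e = m^n>0 X e

  widenˡ : ∀ {k} a e e′ → k ≤ a * X ^ e → k ≤ a * X ^ (e ⊔ e′)
  widenˡ a e e′ k≤ = ≤-trans k≤ (*-monoʳ-≤ a (^-monoʳ-≤ X (m≤m⊔n e e′)))

  widenʳ : ∀ {k} a e e′ → k ≤ a * X ^ e′ → k ≤ a * X ^ (e ⊔ e′)
  widenʳ a e e′ k≤ = ≤-trans k≤ (*-monoʳ-≤ a (^-monoʳ-≤ X (m≤n⊔m e e′)))

  constant : ∀ a e → a ≤ a * X ^ e
  constant a e = ≤-trans (≤-reflexive (sym (*-identityʳ a))) (*-monoʳ-≤ a (1≤pow e))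

  -- The derivation ends in the state that `run` computes, so later proofs need to speak of `run`
  -- only. A sequence adds coefficients at the larger degree; a loop makes at most `X` rounds and
  -- raises the degree by one.
  execute : ∀ c {σ} → T (ok c) → Bounded X σ →
            Σ[ k ∈ ℕ ] (⟨ compile c , σ ⟩⇓⟨ run c σ , k ⟩ × k ≤ coeff c * X ^ degree c)

  module _ (i l : Reg) (c : Code) (N : ℕ) (σ : State)
           (o : T (ok c)) (i∉ : T (notᵇ (i <ᵇ 4))) (l<4 : l < 4) (i∉c : writesReg c i ≡ false)
           (limit : regs σ l ≡ N) (start : regs σ i ≡ 0) (bd : Bounded X σ) where

    after : ℕ → State
    after j = iterations j (increment i ∘ run c) σ

    counter : ∀ j → regs (after j) i ≡ j
    counter zero    = start
    counter (suc j) = trans (update-≡ (regs (run c (after j))) i _)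
      (trans (cong (_+ 1) (trans (regs-run c _ i∉c) (counter j))) (+-comm j 1))

    limit-after : ∀ {x} → x < 4 → ∀ j → regs (after j) x ≡ regs σ x
    limit-after x<4 j = regs-iterations i c σ j (limit≢ x<4 i∉) (limit-kept c o x<4)

    bound : ℕ → ℕ
    bound r = 4 + r * (coeff c * X ^ degree c + 8)

    bound-suc : ∀ {k k′} r → k ≤ coeff c * X ^ degree c → k′ ≤ bound r →
                4 + ((k + 4) + k′) ≤ bound (suc r)
    bound-suc {k} {k′} r k≤ k′≤ = begin
      4 + ((k + 4) + k′)                         ≤⟨ +-monoʳ-≤ 4 (+-mono-≤ (+-monoˡ-≤ 4 k≤) k′≤) ⟩
      4 + ((K + 4) + (4 + r * (K + 8)))          ≡⟨ solve 2 (λ K r → con 4 :+ ((K :+ con 4) :+ (con 4 :+ r)) := con 4 :+ ((K :+ con 8) :+ r)) refl K (r * (K + 8)) ⟩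
      4 + ((K + 8) + r * (K + 8))                ∎
      where
      open ≤-Reasoning
      open +-*-Solver
      K = coeff c * X ^ degree c

    -- Recursion on the rounds `r` still to come. The big-step rule peels off the first round
    -- whereas `iterations` adds the last one; indexing the intermediate states as `after j`
    -- reconciles the two.
    while : ∀ r j → r + j ≡ N →
            Σ[ k ∈ ℕ ] (⟨ WHILE reg i ≺ reg l DO step i c , after j ⟩⇓⟨ after N , k ⟩ × k ≤ bound r)
    while zero    j refl =
      _ , ⇓exit guard , ≤-refl
      where
      guard : (regs (after j) i <ᵇ regs (after j) l) ≡ false
      guard rewrite counter j | limit-after l<4 j | limit
        with j <ᵇ j in eq
      ... | false = refl
      ... | true  = contradiction (<ᵇ⇒< j j (Equivalence.from T-≡ eq)) (<-irrefl refl)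
    while (suc r) j r+j≡N
      with k , d , k≤ ← execute c {after j} o (λ x<4 → subst (_≤ X) (sym (limit-after x<4 j)) (bd x<4))
      with k′ , d′ , k′≤ ← while r (suc j) (trans (+-suc r j) r+j≡N) =
      _ , ⇓loop guard (⇓seq d ⇓reg) d′ , bound-suc r k≤ k′≤
      where
      guard : (regs (after j) i <ᵇ regs (after j) l) ≡ true
      guard rewrite counter j | limit-after l<4 j | limit =
        Equivalence.to T-≡ (<⇒<ᵇ (subst (j <_) r+j≡N (s≤s (m≤n+m j r))))

  execute nop          o bd = _ , ⇓skip , ≤-refl
  execute (x ← e)      o bd = _ , ⇓reg , ≤-reflexive (sym (*-identityʳ _))
  execute (A [ e ]← f) o bd = _ , ⇓arr , ≤-reflexive (sym (*-identityʳ _))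
  execute (c ⨟ c′) o bd
    with o₁ , o₂ ← ∧-T {ok c} o
    with k , d , k≤ ← execute c o₁ bd
    with k′ , d′ , k′≤ ← execute c′ o₂ (bounded-run c o₁ bd) =
    k + k′ , ⇓seq d d′ ,
    ≤-trans (+-mono-≤ (widenˡ (coeff c) (degree c) (degree c′) k≤) (widenʳ (coeff c′) (degree c) (degree c′) k′≤))
            (≤-reflexive (sym (*-distribʳ-+ _ (coeff c) (coeff c′))))
  execute (If p Then c Else c′) {σ} o bd with ∧-T {ok c} o
  ... | o₁ , o₂ with ⟦ p ⟧ᵗ σ in eq
  ...   | true  with k , d , k≤ ← execute c o₁ bd =
    _ , ⇓then eq d , (begin
      suc (costᵗ p) + k                                     ≤⟨ +-mono-≤ (constant (suc (costᵗ p)) D) (widenˡ (coeff c) (degree c) (degree c′) k≤) ⟩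
      suc (costᵗ p) * X ^ D + coeff c * X ^ D               ≡⟨ *-distribʳ-+ (X ^ D) (suc (costᵗ p)) (coeff c) ⟨
      (suc (costᵗ p) + coeff c) * X ^ D                     ≤⟨ *-monoˡ-≤ (X ^ D) (+-monoʳ-≤ (suc (costᵗ p)) (m≤m+n (coeff c) (coeff c′))) ⟩
      (suc (costᵗ p) + (coeff c + coeff c′)) * X ^ D        ∎)
    where
    open ≤-Reasoning
    D = degree c ⊔ degree c′
  ...   | false with k , d , k≤ ← execute c′ o₂ bd =
    _ , ⇓else eq d , (begin
      suc (costᵗ p) + k                                     ≤⟨ +-mono-≤ (constant (suc (costᵗ p)) D) (widenʳ (coeff c′) (degree c) (degree c′) k≤) ⟩
      suc (costᵗ p) * X ^ D + coeff c′ * X ^ D              ≡⟨ *-distribʳ-+ (X ^ D) (suc (costᵗ p)) (coeff c′) ⟨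
      (suc (costᵗ p) + coeff c′) * X ^ D                    ≤⟨ *-monoˡ-≤ (X ^ D) (+-monoʳ-≤ (suc (costᵗ p)) (m≤n+m (coeff c′) (coeff c))) ⟩
      (suc (costᵗ p) + (coeff c + coeff c′)) * X ^ D        ∎)
    where
    open ≤-Reasoning
    D = degree c ⊔ degree c′
  execute (For i Below l Do c) {σ} o bd
    with o₁ , o′ ← ∧-T {notᵇ (i <ᵇ 4)} o
    with o₂ , o″ ← ∧-T {l <ᵇ 4} o′
    with o₃ , o₄ ← ∧-T {notᵇ (writesReg c i)} o″
    with l<4 ← <ᵇ⇒< l 4 o₂
    with k , d , k≤ ← while i l c (regs σ l) (setReg i 0 σ) o₄ o₁ l<4 (not-T o₃)
           (update-false (regs σ) i 0 l (limit≢ l<4 o₁)) (update-≡ (regs σ) i 0)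
           (λ {x} x<4 → subst (_≤ X) (sym (update-false (regs σ) i 0 x (limit≢ x<4 o₁))) (bd x<4))
           (regs σ l) 0 (+-identityʳ _) =
    _ , ⇓seq ⇓reg d , (begin
      2 + k                                        ≤⟨ +-monoʳ-≤ 2 k≤ ⟩
      6 + regs σ l * (K + 8)                       ≤⟨ +-mono-≤ (constant 6 (suc D)) (*-mono-≤ (bd l<4) (+-monoʳ-≤ K (constant 8 D))) ⟩
      6 * (X * X ^ D) + X * (coeff c * X ^ D + 8 * X ^ D)
        ≡⟨ solve 3 (λ a x y → con 6 :* (x :* y) :+ x :* (a :* y :+ con 8 :* y) := (a :+ con 14) :* (x :* y)) refl (coeff c) X (X ^ D) ⟩
      (coeff c + 14) * (X * X ^ D)                 ∎)
    where
    open ≤-Reasoning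
    open +-*-Solver
    D = degree c
    K = coeff c * X ^ D

-- Loop invariants

record Frame (c : Code) (σ τ : State) : Set where
  field
    sameReg : ∀ x → writesReg c x ≡ false → regs τ x ≡ regs σ x
    sameArr : ∀ A → writesArr c A ≡ false → arrs τ A ≡ arrs σ A
open Frame public

frame-run : ∀ c σ → Frame c σ (run c σ)
frame-run c σ .sameReg x = regs-run c σ
frame-run c σ .sameArr A = arrs-run c σ

-- In each round one may assume everything that the whole loop leaves untouched, so an invariant
-- mentions only what the loop changes. The new counter appears as the known number `suc j`, not as
-- an incremented register.
for-rule : ∀ i l c σ → T (ok (For i Below l Do c)) → (Inv : ℕ → State → Set) →
           Inv 0 (setReg i 0 σ) →
           (∀ j τ → j < regs σ l → regs τ i ≡ j → Frame (For i Below l Do c) σ τ →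
              Inv j τ → Inv (suc j) (setReg i (suc j) (run c τ))) →
           Inv (regs σ l) (run (For i Below l Do c) σ)
for-rule i l c σ o Inv base next = go (regs σ l) ≤-refl .proj₁
  where
  i∉c : writesReg c i ≡ false
  i∉c = not-T (∧-T {notᵇ (writesReg c i)} (∧-T {l <ᵇ 4} (∧-T {notᵇ (i <ᵇ 4)} o .proj₂) .proj₂) .proj₁)

  reached : ℕ → State
  reached j = iterations j (increment i ∘ run c) (setReg i 0 σ)

  frame : ∀ j → Frame (For i Below l Do c) σ (reached j)
  frame j .sameReg x w with w₁ , w₂ ← ∨-false w =
    trans (regs-iterations i c _ j w₁ w₂) (update-false (regs σ) i 0 x w₁)
  frame j .sameArr A w = arrs-iterations i c _ j w

  go : ∀ j → j ≤ regs σ l → Inv j (reached j) × regs (reached j) i ≡ j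
  go zero    _   = base , update-≡ (regs σ) i 0
  go (suc j) j<l with inv , eq ← go j (<⇒≤ j<l) =
    subst (λ k → Inv (suc j) (setReg i k (run c (reached j)))) (sym ticks)
      (next j (reached j) j<l eq (frame j) inv) ,
    trans (update-≡ (regs (run c (reached j))) i _) ticks
    where
    ticks : regs (run c (reached j)) i + 1 ≡ suc j
    ticks = trans (cong (_+ 1) (trans (regs-run c _ i∉c) eq)) (+-comm j 1)

-- The recursion for the optimum

-- [ i = k ], in a form that the machine can evaluate.
δ : ℕ → ℕ → ℕ
δ k i = 1 ∸ ((i ∸ k) + (k ∸ i))

δ-refl : ∀ k → δ k k ≡ 1
δ-refl k rewrite n∸n≡0 k = refl

δ-≢ : ∀ {k i} → i ≢ k → δ k i ≡ 0
δ-≢ {k} {i} i≢k with <-cmp i k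
... | tri< i<k _ _ = m≤n⇒m∸n≡0 (≤-trans (m<n⇒0<n∸m i<k) (m≤n+m (k ∸ i) (i ∸ k)))
... | tri≈ _ i≡k _ = contradiction i≡k i≢k
... | tri> _ _ k<i = m≤n⇒m∸n≡0 (≤-trans (m<n⇒0<n∸m k<i) (m≤m+n (i ∸ k) (k ∸ i)))

sum-mono-≤ : ∀ {n} {f g : Fin n → ℕ} → (∀ i → f i ≤ g i) → sum f ≤ sum g
sum-mono-≤ {zero}  f≤g = z≤n
sum-mono-≤ {suc n} f≤g = +-mono-≤ (f≤g zero) (sum-mono-≤ (f≤g ∘ suc))

sum-zero : ∀ {n} {f : Fin n → ℕ} → (∀ i → f i ≡ 0) → sum f ≡ 0
sum-zero {zero}  f≡0 = refl
sum-zero {suc n} f≡0 = cong₂ _+_ (f≡0 zero) (sum-zero (f≡0 ∘ suc))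

-- Sets of tasks are given by characteristic functions ℕ → ℕ.
weight : ℕ → (ℕ → ℕ) → (ℕ → ℕ) → ℕ
weight n w χ = sum {n} (λ i → χ (toℕ i) * w (toℕ i))

weight-δ : ∀ n w {k} → k < n → weight n w (δ k) ≡ w k
weight-δ (suc n) w {zero} _ = trans
  (cong₂ _+_ (+-identityʳ (w 0)) (sum-zero {n} (λ i → cong (_* w (suc (toℕ i))) (δ-≢ {0} {suc (toℕ i)} (λ ())))))
  (+-identityʳ (w 0))
weight-δ (suc n) w {suc k} (s≤s k<n) =
  cong₂ _+_ (cong (_* w 0) (0∸n≡0 k)) (weight-δ n (w ∘ suc) k<n)

weight-+ : ∀ n w χ χ′ → weight n w (λ i → χ i + χ′ i) ≡ weight n w χ + weight n w χ′
weight-+ n w χ χ′ = trans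
  (sum-cong-≗ {n} (λ i → *-distribʳ-+ (w (toℕ i)) (χ (toℕ i)) (χ′ (toℕ i))))
  (∑-distrib-+ {n} (λ i → χ (toℕ i) * w (toℕ i)) (λ i → χ′ (toℕ i) * w (toℕ i)))

weight-mono-≤ : ∀ n w {χ χ′} → (∀ i → i < n → χ i ≤ χ′ i) → weight n w χ ≤ weight n w χ′
weight-mono-≤ n w χ≤ = sum-mono-≤ {n} (λ i → *-monoˡ-≤ (w (toℕ i)) (χ≤ (toℕ i) (toℕ<n i)))

weight-zero : ∀ n w {χ} → (∀ i → i < n → χ i ≡ 0) → weight n w χ ≡ 0
weight-zero n w χ≡0 = sum-zero {n} (λ i → cong (_* w (toℕ i)) (χ≡0 (toℕ i) (toℕ<n i)))

all-below-suc : ∀ {n} {P : ℕ → Set} → (∀ i → i < n → P i) → P n → ∀ i → i < suc n → P i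
all-below-suc below at-n i i<1+n with m<1+n⇒m<n∨m≡n i<1+n
... | inj₁ i<n  = below i i<n
... | inj₂ refl = at-n

minimal : ∀ n (f χ : ℕ → ℕ) →
          (∀ i → i < n → χ i ≡ 0) ⊎
          (∃[ k ] (k < n × 0 < χ k × ∀ i → i < n → 0 < χ i → f k ≤ f i))
minimal zero    f χ = inj₁ (λ _ ())
minimal (suc n) f χ with minimal n f χ | 0 <? χ n
... | inj₁ empty | no ∉n = inj₁ (all-below-suc empty (n≤0⇒n≡0 (≮⇒≥ ∉n)))
... | inj₁ empty | yes ∈n =
  inj₂ (n , ≤-refl , ∈n , all-below-suc (λ i i<n ∈i → contradiction (empty i i<n) (>⇒≢ ∈i)) (λ _ → ≤-refl))
... | inj₂ (k , k<n , ∈k , least) | no ∉n =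
  inj₂ (k , m<n⇒m<1+n k<n , ∈k , all-below-suc least (λ ∈n → contradiction ∈n ∉n))
... | inj₂ (k , k<n , ∈k , least) | yes ∈n with ≤-total (f k) (f n)
...   | inj₁ fk≤fn = inj₂ (k , m<n⇒m<1+n k<n , ∈k , all-below-suc least (λ _ → fk≤fn))
...   | inj₂ fn≤fk =
  inj₂ (n , ≤-refl , ∈n , all-below-suc (λ i i<n ∈i → ≤-trans fn≤fk (least i i<n ∈i)) (λ _ → ≤-refl))

-- `last k` is the bottleneck edge of `k`, also the last vertex where a task to its left may end;
-- `first k` is the first vertex where a task to its right may start. They are separate functions
-- for the sake of the sentinel, index `n`, which gets `first = 0` as a left anchor and `last = m`
-- as a right one; hence the laws are demanded below `n` only.
record Layout (n : ℕ) : Set where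
  field
    s t b ℓ w first last : ℕ → ℕ
    s≤last     : ∀ {k} → k < n → s k ≤ last k
    last<t     : ∀ {k} → k < n → last k < t k
    first≡     : ∀ {k} → k < n → first k ≡ suc (last k)
    ℓ<b        : ∀ {k} → k < n → ℓ k < b k
    bottleneck : ∀ {j k} → j < n → k < n → s j ≤ last k → last k < t j → b j ≤ b k

-- Anchors and the split at a lowest task

module Optimum {n : ℕ} (L : Layout n) where
  open Layout L

  Compat : ℕ → ℕ → Set
  Compat i j = CompatibleRect (rect (s i) (b i) (t i) (ℓ i)) (rect (s j) (b j) (t j) (ℓ j))

  compat-sym : ∀ {i j} → Compat i j → Compat j i
  compat-sym (inj₁ p)               = inj₂ (inj₁ p)
  compat-sym (inj₂ (inj₁ p))        = inj₁ p
  compat-sym (inj₂ (inj₂ (inj₁ p))) = inj₂ (inj₂ (inj₂ p))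
  compat-sym (inj₂ (inj₂ (inj₂ p))) = inj₂ (inj₂ (inj₁ p))

  -- Anchors are chosen by increasing ℓ, whence the last two conditions.
  record Fits (A C k : ℕ) : Set where
    constructor fits
    field
      inside-left  : first A ≤ s k
      inside-right : t k ≤ last C
      clear-left   : t A ≤ s k ⊎ b A ≤ ℓ k
      clear-right  : t k ≤ s C ⊎ b C ≤ ℓ k
      above-left   : ℓ A ≤ ℓ k
      above-right  : ℓ C ≤ ℓ k

  -- The number of edges strictly between the two bottleneck edges. Truncation is harmless: if
  -- `last C` lies before `first A`, no task fits anyway.
  span : ℕ → ℕ → ℕ
  span A C = last C ∸ first A

  span-left : ∀ {A C k} → k < n → Fits A C k → span A k < span A C
  span-left k<n F = ∸-monoˡ-< (<-≤-trans (last<t k<n) inside-right) (≤-trans inside-left (s≤last k<n))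
    where open Fits F

  span-right : ∀ {A C k} → k < n → Fits A C k → span k C < span A C
  span-right {k = k} k<n F rewrite first≡ k<n =
    ∸-monoʳ-< (s≤s (≤-trans inside-left (s≤last k<n))) (≤-trans (last<t k<n) inside-right)
    where open Fits F

  -- Clearance from the far anchor `C` is inherited from `k`: if `k` ends before `C` starts, so does
  -- `j`, which ends before `k` does; if `k` lies above `C`, so does `j`, because `ℓ k ≤ ℓ j`. The
  -- second case is why the order of the bottom sides belongs to `Fits`.
  fits-left : ∀ {A C k j} → k < n → Fits A C k → Fits A k j → Fits A C j
  fits-left {A} {C} {k} {j} k<n F G = record
    { inside-left  = G.inside-left
    ; inside-right = ≤-trans (<⇒≤ tj<tk) F.inside-right
    ; clear-left   = G.clear-left
    ; clear-right  = clear F.clear-right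
    ; above-left   = G.above-left
    ; above-right  = ≤-trans F.above-right G.above-right
    }
    where
    module F = Fits F
    module G = Fits G
    tj<tk : t j < t k
    tj<tk = ≤-<-trans G.inside-right (last<t k<n)
    clear : t k ≤ s C ⊎ b C ≤ ℓ k → t j ≤ s C ⊎ b C ≤ ℓ j
    clear (inj₁ p) = inj₁ (≤-trans (<⇒≤ tj<tk) p)
    clear (inj₂ p) = inj₂ (≤-trans p G.above-right)

  fits-right : ∀ {A C k j} → k < n → Fits A C k → Fits k C j → Fits A C j
  fits-right {A} {C} {k} {j} k<n F G = record
    { inside-left  = ≤-trans F.inside-left sk≤sj
    ; inside-right = G.inside-right
    ; clear-left   = clear F.clear-left
    ; clear-right  = G.clear-right
    ; above-left   = ≤-trans F.above-left G.above-left
    ; above-right  = G.above-right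
    }
    where
    module F = Fits F
    module G = Fits G
    sk≤sj : s k ≤ s j
    sk≤sj = ≤-trans (s≤last k<n) (≤-trans (≤-trans (n≤1+n _) (≤-reflexive (sym (first≡ k<n)))) G.inside-left)
    clear : t A ≤ s k ⊎ b A ≤ ℓ k → t A ≤ s j ⊎ b A ≤ ℓ j
    clear (inj₁ p) = inj₁ (≤-trans p sk≤sj)
    clear (inj₂ p) = inj₂ (≤-trans p G.above-left)

  left-compat : ∀ {A k j} → Fits A k j → Compat j k
  left-compat F with Fits.clear-right F
  ... | inj₁ p = inj₁ p
  ... | inj₂ p = inj₂ (inj₂ (inj₂ p))

  right-compat : ∀ {k C j} → Fits k C j → Compat k j
  right-compat F with Fits.clear-left F
  ... | inj₁ p = inj₁ p
  ... | inj₂ p = inj₂ (inj₂ (inj₁ p))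

  sides-apart : ∀ {A C k i j} → k < n → Fits A k i → Fits k C j → t i ≤ s j
  sides-apart k<n F G = ≤-trans (Fits.inside-right F)
    (≤-trans (≤-trans (n≤1+n _) (≤-reflexive (sym (first≡ k<n)))) (Fits.inside-left G))

  -- A task j over the bottleneck edge of k has b j ≤ b k, and ℓ k ≤ ℓ j < b j
  -- puts both rectangles just below b j on that edge.
  split : ∀ {A C k j} → k < n → j < n → Fits A C k → Fits A C j → Compat j k → ℓ k ≤ ℓ j →
          Fits A k j ⊎ Fits k C j
  split {A} {C} {k} {j} k<n j<n F G jk ℓk≤ℓj with t j ≤? last k | first k ≤? s j
  ... | yes tj≤ | _ = inj₁ record
    { inside-left = G.inside-left ; inside-right = tj≤ ; clear-left = G.clear-left
    ; clear-right = clear jk ; above-left = G.above-left ; above-right = ℓk≤ℓj }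
    where
    module G = Fits G
    clear : Compat j k → t j ≤ s k ⊎ b k ≤ ℓ j
    clear (inj₁ p)               = inj₁ p
    clear (inj₂ (inj₁ p))        = contradiction
      (<-≤-trans (last<t k<n) (≤-trans p (≤-trans (≤-trans (s≤last j<n) (<⇒≤ (last<t j<n))) tj≤))) (<-irrefl refl)
    clear (inj₂ (inj₂ (inj₁ p))) = contradiction (<-≤-trans (ℓ<b j<n) (≤-trans p ℓk≤ℓj)) (<-irrefl refl)
    clear (inj₂ (inj₂ (inj₂ p))) = inj₂ p
  ... | no _ | yes ≤sj = inj₂ record
    { inside-left = ≤sj ; inside-right = G.inside-right ; clear-left = clear jk
    ; clear-right = G.clear-right ; above-left = ℓk≤ℓj ; above-right = G.above-right }
    where
    module G = Fits G
    sk<sj : s k < s j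
    sk<sj = ≤-trans (s≤s (s≤last k<n)) (≤-trans (≤-reflexive (sym (first≡ k<n))) ≤sj)
    clear : Compat j k → t k ≤ s j ⊎ b k ≤ ℓ j
    clear (inj₁ p)               = contradiction
      (<-trans (≤-<-trans (s≤last j<n) (last<t j<n)) (≤-<-trans p sk<sj)) (<-irrefl refl)
    clear (inj₂ (inj₁ p))        = inj₁ p
    clear (inj₂ (inj₂ (inj₁ p))) = contradiction (<-≤-trans (ℓ<b j<n) (≤-trans p ℓk≤ℓj)) (<-irrefl refl)
    clear (inj₂ (inj₂ (inj₂ p))) = inj₂ p
  ... | no tj≰ | no ≰sj = clash jk
    where
    over-right : last k < t j
    over-right = ≰⇒> tj≰
    over-left : s j ≤ last k
    over-left = ≤-pred (subst (s j <_) (first≡ k<n) (≰⇒> ≰sj))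
    clash : ∀ {P : Set} → Compat j k → P
    clash (inj₁ p)               = contradiction (<-≤-trans over-right (≤-trans p (s≤last k<n))) (<-irrefl refl)
    clash (inj₂ (inj₁ p))        = contradiction (<-≤-trans (last<t k<n) (≤-trans p over-left)) (<-irrefl refl)
    clash (inj₂ (inj₂ (inj₁ p))) = contradiction (<-≤-trans (ℓ<b j<n) (≤-trans p ℓk≤ℓj)) (<-irrefl refl)
    clash (inj₂ (inj₂ (inj₂ p))) = contradiction
      (<-≤-trans (ℓ<b j<n) (≤-trans (bottleneck j<n k<n over-left over-right) p)) (<-irrefl refl)

  -- Gluing and cutting independent sets

  record Independent (A C : ℕ) (χ : ℕ → ℕ) : Set where
    field
      bit    : ∀ {i} → i < n → χ i ≤ 1
      fitted : ∀ {i} → i < n → 0 < χ i → Fits A C i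
      compat : ∀ {i j} → i < n → j < n → 0 < χ i → 0 < χ j → i ≢ j → Compat i j

  record Optimal (A C v : ℕ) (χ : ℕ → ℕ) : Set where
    field
      independent : Independent A C χ
      value       : v ≡ weight n w χ
      upper       : ∀ ψ → Independent A C ψ → weight n w ψ ≤ v

  weight-split : ∀ k {χ χ′} → k < n →
                 weight n w (λ i → χ i + χ′ i + δ k i) ≡ weight n w χ + weight n w χ′ + w k
  weight-split k {χ} {χ′} k<n = trans (weight-+ n w (λ i → χ i + χ′ i) (δ k))
    (cong₂ _+_ (weight-+ n w χ χ′) (weight-δ n w k<n))

  not-self-left : ∀ {A k} → k < n → ¬ Fits A k k
  not-self-left k<n F = <-irrefl refl (<-≤-trans (last<t k<n) (Fits.inside-right F))

  not-self-right : ∀ {k C} → k < n → ¬ Fits k C k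
  not-self-right k<n F = <-irrefl refl
    (≤-trans (≤-trans (s≤s (s≤last k<n)) (≤-reflexive (sym (first≡ k<n)))) (Fits.inside-left F))

  -- Turns the pointwise sum of three characteristic functions into a disjoint union: each
  -- constructor names the one summand that is nonzero at `i`, or none, and evaluates the sum
  -- accordingly.
  data Member (A C k : ℕ) (χ χ′ : ℕ → ℕ) (i : ℕ) : Set where
    ∈left  : 0 < χ i → Fits A k i → χ i + χ′ i + δ k i ≡ χ i → Member A C k χ χ′ i
    ∈right : 0 < χ′ i → Fits k C i → χ i + χ′ i + δ k i ≡ χ′ i → Member A C k χ χ′ i
    ∈mid   : i ≡ k → χ i + χ′ i + δ k i ≡ 1 → Member A C k χ χ′ i
    ∉all   : χ i + χ′ i + δ k i ≡ 0 → Member A C k χ χ′ i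

  -- At `k` both side sets vanish, since `k` does not fit next to itself; elsewhere a task in both
  -- of them would have to end before it starts.
  member : ∀ {A C k χ χ′ i} → k < n → i < n → Independent A k χ → Independent k C χ′ →
           Member A C k χ χ′ i
  member {A} {C} {k} {χ} {χ′} {i} k<n i<n I J with i ≟ k
  ... | yes refl = ∈mid refl sum≡1
    where
    χ0 : χ k ≡ 0
    χ0 = n≤0⇒n≡0 (≮⇒≥ (λ p → not-self-left k<n (Independent.fitted I k<n p)))
    χ′0 : χ′ k ≡ 0
    χ′0 = n≤0⇒n≡0 (≮⇒≥ (λ p → not-self-right k<n (Independent.fitted J k<n p)))
    sum≡1 : χ k + χ′ k + δ k k ≡ 1
    sum≡1 rewrite χ0 | χ′0 = δ-refl k
  ... | no i≢k with 0 <? χ i | 0 <? χ′ i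
  ...   | yes p | yes q = contradiction
    (sides-apart k<n (Independent.fitted I i<n p) (Independent.fitted J i<n q))
    (<⇒≱ (≤-<-trans (s≤last i<n) (last<t i<n)))
  ...   | yes p | no ¬q = ∈left p (Independent.fitted I i<n p) eq
    where
    eq : χ i + χ′ i + δ k i ≡ χ i
    eq rewrite n≤0⇒n≡0 (≮⇒≥ ¬q) | δ-≢ i≢k | +-identityʳ (χ i) = +-identityʳ (χ i)
  ...   | no ¬p | yes q = ∈right q (Independent.fitted J i<n q) eq
    where
    eq : χ i + χ′ i + δ k i ≡ χ′ i
    eq rewrite n≤0⇒n≡0 (≮⇒≥ ¬p) | δ-≢ i≢k = +-identityʳ (χ′ i)
  ...   | no ¬p | no ¬q = ∉all eq
    where
    eq : χ i + χ′ i + δ k i ≡ 0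
    eq rewrite n≤0⇒n≡0 (≮⇒≥ ¬p) | n≤0⇒n≡0 (≮⇒≥ ¬q) = δ-≢ i≢k

  join : ∀ {A C k χ χ′} → k < n → Fits A C k → Independent A k χ → Independent k C χ′ →
         Independent A C (λ i → χ i + χ′ i + δ k i)
  join {A} {C} {k} {χ} {χ′} k<n F I J = record { bit = bit ; fitted = fitted ; compat = compat }
    where
    module I = Independent I
    module J = Independent J
    χ∪ : ℕ → ℕ
    χ∪ i = χ i + χ′ i + δ k i

    bit : ∀ {i} → i < n → χ∪ i ≤ 1
    bit {i} i<n with member k<n i<n I J
    ... | ∈left _ _ eq  = subst (_≤ 1) (sym eq) (I.bit i<n)
    ... | ∈right _ _ eq = subst (_≤ 1) (sym eq) (J.bit i<n)
    ... | ∈mid _ eq     = ≤-reflexive eq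
    ... | ∉all eq       = subst (_≤ 1) (sym eq) z≤n

    fitted : ∀ {i} → i < n → 0 < χ∪ i → Fits A C i
    fitted {i} i<n 0< with member k<n i<n I J
    ... | ∈left _ G _  = fits-left k<n F G
    ... | ∈right _ G _ = fits-right k<n F G
    ... | ∈mid refl _  = F
    ... | ∉all eq      = contradiction eq (>⇒≢ 0<)

    compat : ∀ {i j} → i < n → j < n → 0 < χ∪ i → 0 < χ∪ j → i ≢ j → Compat i j
    compat {i} {j} i<n j<n 0<i 0<j i≢j with member k<n i<n I J | member k<n j<n I J
    ... | ∉all eq      | _            = contradiction eq (>⇒≢ 0<i)
    ... | _            | ∉all eq      = contradiction eq (>⇒≢ 0<j)
    ... | ∈left p _ _  | ∈left q _ _  = I.compat i<n j<n p q i≢j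
    ... | ∈right p _ _ | ∈right q _ _ = J.compat i<n j<n p q i≢j
    ... | ∈left _ G _  | ∈right _ H _ = inj₁ (sides-apart k<n G H)
    ... | ∈right _ G _ | ∈left _ H _  = compat-sym {j} {i} (inj₁ (sides-apart k<n H G))
    ... | ∈mid refl _  | ∈mid refl _  = contradiction refl i≢j
    ... | ∈left _ G _  | ∈mid refl _  = left-compat G
    ... | ∈mid refl _  | ∈left _ H _  = compat-sym {j} {k} (left-compat H)
    ... | ∈right _ G _ | ∈mid refl _  = compat-sym {k} {i} (right-compat G)
    ... | ∈mid refl _  | ∈right _ H _ = right-compat H

  keep : ∀ {P : ℕ → Set} → (∀ i → Dec (P i)) → (ℕ → ℕ) → ℕ → ℕ
  keep P? ψ i = if does (P? i) then ψ i else 0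

  keep-≤ : ∀ {P : ℕ → Set} (P? : ∀ i → Dec (P i)) ψ i → keep P? ψ i ≤ ψ i
  keep-≤ P? ψ i with P? i
  ... | yes _ = ≤-refl
  ... | no  _ = z≤n

  keep-yes : ∀ {P : ℕ → Set} (P? : ∀ i → Dec (P i)) ψ {i} → P i → keep P? ψ i ≡ ψ i
  keep-yes P? ψ {i} p with P? i
  ... | yes _ = refl
  ... | no ¬p = contradiction p ¬p

  keep-∈ : ∀ {P : ℕ → Set} (P? : ∀ i → Dec (P i)) ψ {i} → 0 < keep P? ψ i → P i
  keep-∈ P? ψ {i} 0< with P? i
  ... | yes p = p

  independent-keep : ∀ {P : ℕ → Set} (P? : ∀ i → Dec (P i)) {A C A′ C′ ψ} → Independent A C ψ →
                     (∀ {i} → i < n → 0 < ψ i → P i → Fits A′ C′ i) → Independent A′ C′ (keep P? ψ)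
  independent-keep P? {ψ = ψ} I fit = record
    { bit    = λ {i} i<n → ≤-trans (keep-≤ P? ψ i) (I.bit i<n)
    ; fitted = λ {i} i<n 0< → fit i<n (<-≤-trans 0< (keep-≤ P? ψ i)) (keep-∈ P? ψ 0<)
    ; compat = λ {i} {j} i<n j<n 0<i 0<j → I.compat i<n j<n
                 (<-≤-trans 0<i (keep-≤ P? ψ i)) (<-≤-trans 0<j (keep-≤ P? ψ j))
    }
    where module I = Independent I

  module _ {A C k : ℕ} {ψ : ℕ → ℕ} (k<n : k < n) (I : Independent A C ψ) (k∈ψ : 0 < ψ k)
           (lowest : ∀ i → i < n → 0 < ψ i → ℓ k ≤ ℓ i) where

    private
      module I = Independent I

      F : Fits A C k
      F = I.fitted k<n k∈ψ

      last<first : last k < first k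
      last<first = ≤-reflexive (sym (first≡ k<n))

      part : ∀ {j} → j < n → 0 < ψ j → j ≢ k → Fits A k j ⊎ Fits k C j
      part j<n 0<j j≢k = split k<n j<n F (I.fitted j<n 0<j) (I.compat j<n k<n 0<j k∈ψ j≢k) (lowest _ j<n 0<j)

      left? : ∀ i → Dec (t i ≤ last k)
      left? i = t i ≤? last k

      right? : ∀ i → Dec (first k ≤ s i)
      right? i = first k ≤? s i

      -- The filter looks at the position only. The other conditions come from `part`, whose second
      -- alternative contradicts the position; `k` itself fails the test because it uses its own
      -- bottleneck edge.
      left-fits : ∀ {j} → j < n → 0 < ψ j → t j ≤ last k → Fits A k j
      left-fits {j} j<n 0<j tj≤ with j ≟ k
      ... | yes refl = contradiction (last<t k<n) (≤⇒≯ tj≤)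
      ... | no j≢k with part j<n 0<j j≢k
      ...   | inj₁ G = G
      ...   | inj₂ G = contradiction (≤-trans (<-trans (last<t j<n) (≤-<-trans tj≤ last<first)) (Fits.inside-left G))
                                     (≤⇒≯ (s≤last j<n))

      right-fits : ∀ {j} → j < n → 0 < ψ j → first k ≤ s j → Fits k C j
      right-fits {j} j<n 0<j ≤sj with j ≟ k
      ... | yes refl = contradiction (≤-trans last<first ≤sj) (≤⇒≯ (s≤last k<n))
      ... | no j≢k with part j<n 0<j j≢k
      ...   | inj₁ G = contradiction (<-≤-trans last<first (≤-trans ≤sj (≤-trans (s≤last j<n) (<⇒≤ (last<t j<n)))))
                                     (≤⇒≯ (Fits.inside-right G))
      ...   | inj₂ G = G

    -- Here `lower` and `upper` refer to positions along the path, left and right of the bottleneck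
    -- edge of `k`, not to heights.
    lower-part : Independent A k (keep left? ψ)
    lower-part = independent-keep left? I left-fits

    upper-part : Independent k C (keep right? ψ)
    upper-part = independent-keep right? I right-fits

    parts-cover : ∀ i → i < n → ψ i ≤ keep left? ψ i + keep right? ψ i + δ k i
    parts-cover i i<n with i ≟ k | 0 <? ψ i
    ... | _        | no ¬0<  = ≤-trans (≮⇒≥ ¬0<) z≤n
    ... | yes refl | yes 0<i = ≤-trans (I.bit i<n) (≤-trans (≤-reflexive (sym (δ-refl k))) (m≤n+m _ _))
    ... | no i≢k   | yes 0<i with part i<n 0<i i≢k
    ...   | inj₁ G = ≤-trans (≤-reflexive (sym (keep-yes left? ψ (Fits.inside-right G))))
                             (≤-trans (m≤m+n _ _) (m≤m+n _ _))
    ...   | inj₂ G = ≤-trans (≤-reflexive (sym (keep-yes right? ψ (Fits.inside-left G))))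
                             (≤-trans (m≤n+m _ (keep left? ψ i)) (m≤m+n _ _))

    weight-parts : weight n w ψ ≤ weight n w (keep left? ψ) + weight n w (keep right? ψ) + w k
    weight-parts = ≤-trans (weight-mono-≤ n w parts-cover)
      (≤-reflexive (weight-split k {keep left? ψ} {keep right? ψ} k<n))

  module _ {A C v : ℕ} (V : ℕ → ℕ → ℕ) (S : ℕ → ℕ → ℕ → ℕ)
           (best : ∀ {k} → k < n → Fits A C k → V A k + V k C + w k ≤ v)
           (opt : ∀ {k} → k < n → Fits A C k → Optimal A k (V A k) (S A k) × Optimal k C (V k C) (S k C))
           where

    -- It suffices that `v` dominates the gain of every fitting task: a nonempty `ψ` is cut at its
    -- lowest task and both parts are bounded by the optima of the shorter pairs. That `v` is
    -- attained is left to the next two lemmas.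
    upper-bound : ∀ ψ → Independent A C ψ → weight n w ψ ≤ v
    upper-bound ψ I with minimal n ℓ ψ
    ... | inj₁ empty = ≤-trans (≤-reflexive (weight-zero n w empty)) z≤n
    ... | inj₂ (k , k<n , k∈ψ , lowest)
      with F ← Independent.fitted I k<n k∈ψ with O , O′ ← opt k<n F =
      ≤-trans (weight-parts k<n I k∈ψ lowest) (≤-trans (+-monoˡ-≤ (w k)
        (+-mono-≤ (Optimal.upper O _ (lower-part k<n I k∈ψ lowest))
                  (Optimal.upper O′ _ (upper-part k<n I k∈ψ lowest)))) (best k<n F))

    optimal-none : v ≡ 0 → ∀ {χ} → (∀ i → i < n → χ i ≡ 0) → Optimal A C v χ
    optimal-none v≡0 {χ} χ≡0 = record
      { independent = record
        { bit    = λ i<n → subst (_≤ 1) (sym (χ≡0 _ i<n)) z≤n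
        ; fitted = λ i<n 0< → contradiction (χ≡0 _ i<n) (>⇒≢ 0<)
        ; compat = λ i<n _ 0< → contradiction (χ≡0 _ i<n) (>⇒≢ 0<)
        }
      ; value = trans v≡0 (sym (weight-zero n w χ≡0))
      ; upper = upper-bound
      }

    optimal-via : ∀ {k} → k < n → Fits A C k → v ≡ V A k + V k C + w k →
                  Optimal A C v (λ i → S A k i + S k C i + δ k i)
    optimal-via {k} k<n F v≡ with O , O′ ← opt k<n F = record
      { independent = join k<n F (Optimal.independent O) (Optimal.independent O′)
      ; value = trans v≡ (trans
          (cong₂ (λ x y → x + y + w k) (Optimal.value O) (Optimal.value O′))
          (sym (weight-split k {S A k} {S k C} k<n)))
      ; upper = upper-bound
      }

  -- Carries optimality from one memory state to another: the stored set counts only at indices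
  -- below `n`.
  optimal-cong : ∀ {A C v v′ χ χ′} → v ≡ v′ → (∀ i → i < n → χ i ≡ χ′ i) → Optimal A C v χ → Optimal A C v′ χ′
  optimal-cong refl χ≗ O = record
    { independent = record
      { bit    = λ i<n → subst (_≤ 1) (χ≗ _ i<n) (I.bit i<n)
      ; fitted = λ i<n 0< → I.fitted i<n (back i<n 0<)
      ; compat = λ i<n j<n 0<i 0<j → I.compat i<n j<n (back i<n 0<i) (back j<n 0<j)
      }
    ; value = trans O.value (≤-antisym (weight-mono-≤ n w (λ i i<n → ≤-reflexive (χ≗ i i<n)))
                                        (weight-mono-≤ n w (λ i i<n → ≤-reflexive (sym (χ≗ i i<n)))))
    ; upper = O.upper
    }
    where
    module O = Optimal O
    module I = Independent O.independent
    back : ∀ {i} → i < n → 0 < _ → 0 < _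
    back i<n = subst (0 <_) (sym (χ≗ _ i<n))

-- The program and its dynamic programming phase

infix 5 _≼_

_≼_ : Exp → Exp → Test
e ≼ f = not (f ≺ e)

≼-sound : ∀ a b → T (notᵇ (b <ᵇ a)) → a ≤ b
≼-sound a b p = ≮⇒≥ (λ b<a → subst (T ∘ notᵇ) (Equivalence.to T-≡ (<⇒<ᵇ b<a)) p)

≼-complete : ∀ {a b} → a ≤ b → T (notᵇ (b <ᵇ a))
≼-complete {a} {b} a≤b with b <ᵇ a in eq
... | false = _
... | true  = contradiction a≤b (<⇒≱ (<ᵇ⇒< b a (Equivalence.from T-≡ eq)))

-- Registers 0 to 3 hold n, m, n + 1 and m + 1; registers 4 to 7 are loop
-- counters, 8 and 9 the best value so far and its argument (9 holding n as long
-- as no task fits between the anchors).  Arrays 6 to 9 hold b, ℓ, the bottleneck edge e and e + 1 of each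
-- task; their cells n describe the sentinel that bounds the whole path.
-- Arrays 10 and 11 are multiplication tables for the addresses of the pairs
-- of anchors, 12 and 13 the values and the solutions found for the pairs.
_at_ : Arr → Reg → Exp
A at x = A ‼ reg x

pair : Reg → Reg → Exp
pair x y = 10 at x ⊕ 11 at y

scanTest : Test
scanTest = 1 at 4 ≼ reg 5 and reg 5 ≺ 2 at 4 and 0 at 5 ≺ reg 8

scanStep scanEdges : Code
scanStep  = If scanTest Then (8 ← 0 at 5 ⨟ 9 ← reg 5) Else nop
scanEdges = For 5 Below 1 Do scanStep

-- The minimum is seeded with the start edge of the task, which the task uses, so that no artificial
-- infinite capacity is needed.
bottleneckStep bottlenecks : Code
bottleneckStep =
    9 ← 1 at 4
  ⨟ 8 ← 0 at 9
  ⨟ scanEdges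
  ⨟ 6 [ reg 4 ]← reg 8
  ⨟ 7 [ reg 4 ]← reg 8 ⊖ 3 at 4
  ⨟ 8 [ reg 4 ]← reg 9
  ⨟ 9 [ reg 4 ]← reg 9 ⊕ lit 1
bottlenecks = For 4 Below 0 Do bottleneckStep

table : Arr → Exp → Code
table B e = For 4 Below 2 Do (B [ reg 4 ⊕ lit 1 ]← B at 4 ⊕ e)

fitsTest : Test
fitsTest = 9 at 5 ≼ 1 at 7 and 2 at 7 ≼ 8 at 6
  and (2 at 5 ≼ 1 at 7 or 6 at 5 ≼ 7 at 7)
  and (2 at 7 ≼ 1 at 6 or 6 at 6 ≼ 7 at 7)
  and 7 at 5 ≼ 7 at 7 and 7 at 6 ≼ 7 at 7

candidate : Exp
candidate = 12 ‼ pair 5 7 ⊕ 12 ‼ pair 7 6 ⊕ 4 at 7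

searchStep : Code
searchStep = If fitsTest and reg 8 ≺ candidate Then 8 ← candidate ⨟ 9 ← reg 7 Else nop

search : Code
search = For 7 Below 0 Do searchStep

union : Exp
union = 13 ‼ (pair 5 9 ⊕ reg 7) ⊕ 13 ‼ (pair 9 6 ⊕ reg 7)
      ⊕ (lit 1 ⊖ ((reg 7 ⊖ reg 9) ⊕ (reg 9 ⊖ reg 7)))

copyUnion copyZero copyStep copy : Code
copyUnion = 13 [ pair 5 6 ⊕ reg 7 ]← union
copyZero  = 13 [ pair 5 6 ⊕ reg 7 ]← lit 0
copyStep  = If reg 9 ≺ reg 0 Then copyUnion Else copyZero
copy      = For 7 Below 0 Do copyStep

solvePair : Code
solvePair = 8 ← lit 0 ⨟ 9 ← reg 0 ⨟ search ⨟ 12 [ pair 5 6 ]← reg 8 ⨟ copy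

row : Code
row = For 6 Below 2 Do solvePair

sweep : Code
sweep = For 5 Below 2 Do row

sweeps : Code
sweeps = For 4 Below 3 Do sweep

-- Register 0 holds `n`, which is also the index of the sentinel, so `pair 0 0` addresses the pair
-- that admits all tasks.
extract : Code
extract = For 7 Below 0 Do (5 [ reg 7 ]← 13 ‼ (pair 0 0 ⊕ reg 7))

dynamic : Code
dynamic = sweeps ⨟ extract

-- Write `N` for `n + 1`, held in register 2. The first table runs one entry beyond the last anchor:
-- its cell `N` is the square of `N`, exactly the summand from which the second table is built.
prepare : Code
prepare = bottlenecks ⨟ 8 [ reg 0 ]← reg 1 ⨟ table 11 (reg 2) ⨟ table 10 (11 at 2)

main : Code
main = prepare ⨟ dynamic

main-ok : T (ok main)
main-ok = _

run-true : ∀ p c c′ σ → ⟦ p ⟧ᵗ σ ≡ true → run (If p Then c Else c′) σ ≡ run c σ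
run-true p c c′ σ eq rewrite eq = refl

run-false : ∀ p c c′ σ → ⟦ p ⟧ᵗ σ ≡ false → run (If p Then c Else c′) σ ≡ run c′ σ
run-false p c c′ σ eq rewrite eq = refl

positional-injective : ∀ N x x′ {y y′} → y < N → y′ < N → x * N + y ≡ x′ * N + y′ → x ≡ x′ × y ≡ y′
positional-injective N zero zero _ _ eq = refl , eq
positional-injective N zero (suc x′) {y} {y′} y<N _ eq =
  contradiction (subst (N ≤_) (sym eq) (≤-trans (m≤m+n N (x′ * N)) (m≤m+n _ y′))) (<⇒≱ y<N)
positional-injective N (suc x) zero {y} {y′} _ y′<N eq =
  contradiction (subst (N ≤_) eq (≤-trans (m≤m+n N (x * N)) (m≤m+n _ y))) (<⇒≱ y′<N)
positional-injective N (suc x) (suc x′) {y} {y′} y<N y′<N eq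
  with x≡ , y≡ ← positional-injective N x x′ y<N y′<N
         (+-cancelˡ-≡ N _ _ (trans (sym (+-assoc N (x * N) y)) (trans eq (+-assoc N (x′ * N) y′)))) =
  cong suc x≡ , y≡

-- Reserves `suc n` cells per pair, so that `A`, `C` and an offset are the digits of a cell number
-- in base `suc n`. The values in array 12 occupy only the first cell of each block; thus one
-- address serves both arrays.
address : ℕ → ℕ → ℕ → ℕ
address n A C = (A * suc n + C) * suc n

address-injective : ∀ n {A C i A′ C′ i′} → C ≤ n → C′ ≤ n → i ≤ n → i′ ≤ n →
                    address n A C + i ≡ address n A′ C′ + i′ → A ≡ A′ × C ≡ C′ × i ≡ i′
address-injective n {A} {C} {i} {A′} {C′} {i′} C≤ C′≤ i≤ i′≤ eq
  with q , i≡ ← positional-injective (suc n) (A * suc n + C) (A′ * suc n + C′) (s≤s i≤) (s≤s i′≤) eq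
  with A≡ , C≡ ← positional-injective (suc n) A A′ (s≤s C≤) (s≤s C′≤) q = A≡ , C≡ , i≡

-- The interface between the two phases: the geometry of the tasks as it stands in memory, together
-- with the address tables.
record Tables (n : ℕ) (σ : State) : Set where
  s : ℕ → ℕ
  s = arrs σ 1
  t : ℕ → ℕ
  t = arrs σ 2
  w : ℕ → ℕ
  w = arrs σ 4
  b : ℕ → ℕ
  b = arrs σ 6
  ℓ : ℕ → ℕ
  ℓ = arrs σ 7
  last : ℕ → ℕ
  last = arrs σ 8
  first : ℕ → ℕ
  first = arrs σ 9
  field
    s≤last     : ∀ {k} → k < n → s k ≤ last k
    last<t     : ∀ {k} → k < n → last k < t k
    first≡     : ∀ {k} → k < n → first k ≡ suc (last k)
    ℓ<b        : ∀ {k} → k < n → ℓ k < b k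
    bottleneck : ∀ {j k} → j < n → k < n → s j ≤ last k → last k < t j → b j ≤ b k
    rows       : ∀ {A} → A ≤ n → arrs σ 10 A ≡ A * (suc n * suc n)
    cols       : ∀ {C} → C ≤ n → arrs σ 11 C ≡ C * suc n

-- Invariants of a pair, a row and a sweep

module Dynamic (σ₀ : State) (n rounds : ℕ) (tables : Tables n σ₀) where
  open Tables tables

  layout : Layout n
  layout = record
    { s = s ; t = t ; b = b ; ℓ = ℓ ; w = w ; first = first ; last = last
    ; s≤last = s≤last ; last<t = last<t ; first≡ = first≡ ; ℓ<b = ℓ<b ; bottleneck = bottleneck }

  open Optimum layout public

  -- The dynamic phase writes only arrays 5, 12 and 13, so the layout read from `σ₀` stays valid in
  -- every state it passes through.
  Static : State → Set
  Static τ = (regs τ 0 ≡ n × regs τ 2 ≡ suc n × regs τ 3 ≡ rounds) ×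
             (∀ B → writesArr dynamic B ≡ false → arrs τ B ≡ arrs σ₀ B)

  static-frame : ∀ c {σ τ} → writesReg c 0 ≡ false → writesReg c 2 ≡ false → writesReg c 3 ≡ false →
                 (∀ B → writesArr dynamic B ≡ false → writesArr c B ≡ false) →
                 Frame c σ τ → Static σ → Static τ
  static-frame c w0 w2 w3 wB fr ((r0 , r2 , r3) , mem) =
    (trans (sameReg fr 0 w0) r0 , trans (sameReg fr 2 w2) r2 , trans (sameReg fr 3 w3) r3) ,
    λ B wr → trans (sameArr fr B (wB B wr)) (mem B wr)

  V : State → ℕ → ℕ → ℕ
  V τ A C = arrs τ 12 (address n A C)

  S : State → ℕ → ℕ → ℕ → ℕ
  S τ A C i = arrs τ 13 (address n A C + i)

  Solved : State → ℕ → ℕ → Set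
  Solved τ A C = Optimal A C (V τ A C) (S τ A C)

  pair-value : ∀ {τ x y A C} → Static τ → regs τ x ≡ A → regs τ y ≡ C → A ≤ n → C ≤ n →
               ⟦ pair x y ⟧ τ ≡ address n A C
  pair-value {A = A} {C} (_ , mem) refl refl A≤n C≤n
    rewrite mem 10 refl | mem 11 refl | rows A≤n | cols C≤n =
    solve 3 (λ A C N → A :* (N :* N) :+ C :* N := (A :* N :+ C) :* N) refl A C (suc n)
    where open +-*-Solver

  test-sound : ∀ τ → Static τ → T (⟦ fitsTest ⟧ᵗ τ) → Fits (regs τ 5) (regs τ 6) (regs τ 7)
  test-sound τ (_ , mem) p
    rewrite mem 1 refl | mem 2 refl | mem 6 refl | mem 7 refl | mem 8 refl | mem 9 refl
    with p₁ , p ← ∧-T {notᵇ (s (regs τ 7) <ᵇ first (regs τ 5))} p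
    with p₂ , p ← ∧-T {notᵇ (last (regs τ 6) <ᵇ t (regs τ 7))} p
    with p₃ , p ← ∧-T {notᵇ (s (regs τ 7) <ᵇ t (regs τ 5)) ∨ᵇ notᵇ (ℓ (regs τ 7) <ᵇ b (regs τ 5))} p
    with p₄ , p ← ∧-T {notᵇ (s (regs τ 6) <ᵇ t (regs τ 7)) ∨ᵇ notᵇ (ℓ (regs τ 7) <ᵇ b (regs τ 6))} p
    with p₅ , p₆ ← ∧-T {notᵇ (ℓ (regs τ 7) <ᵇ ℓ (regs τ 5))} p = record
    { inside-left  = ≼-sound _ _ p₁
    ; inside-right = ≼-sound _ _ p₂
    ; clear-left   = either (Equivalence.to (T-∨ {notᵇ (s (regs τ 7) <ᵇ t (regs τ 5))}) p₃)
    ; clear-right  = either (Equivalence.to (T-∨ {notᵇ (s (regs τ 6) <ᵇ t (regs τ 7))}) p₄)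
    ; above-left   = ≼-sound _ _ p₅
    ; above-right  = ≼-sound _ _ p₆
    }
    where
    either : ∀ {a b c d} → T (notᵇ (b <ᵇ a)) ⊎ T (notᵇ (d <ᵇ c)) → a ≤ b ⊎ c ≤ d
    either (inj₁ q) = inj₁ (≼-sound _ _ q)
    either (inj₂ q) = inj₂ (≼-sound _ _ q)

  test-complete : ∀ τ → Static τ → Fits (regs τ 5) (regs τ 6) (regs τ 7) → T (⟦ fitsTest ⟧ᵗ τ)
  test-complete τ (_ , mem) F
    rewrite mem 1 refl | mem 2 refl | mem 6 refl | mem 7 refl | mem 8 refl | mem 9 refl =
    ≼-complete F.inside-left & ≼-complete F.inside-right & either F.clear-left & either F.clear-right
      & ≼-complete F.above-left & ≼-complete F.above-right
    where
    module F = Fits F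
    infixr 4 _&_
    _&_ : ∀ {a b} → T a → T b → T (a ∧ᵇ b)
    p & q = Equivalence.from T-∧ (p , q)
    either : ∀ {a b c d} → a ≤ b ⊎ c ≤ d → T (notᵇ (b <ᵇ a) ∨ᵇ notᵇ (d <ᵇ c))
    either {a} {b} (inj₁ q) = Equivalence.from T-∨ (inj₁ (≼-complete q))
    either {a} {b} (inj₂ q) = Equivalence.from (T-∨ {notᵇ (b <ᵇ a)}) (inj₂ (≼-complete q))

  module Pair (τ : State) (st : Static τ) (A C : ℕ) (A≤n : A ≤ n) (C≤n : C ≤ n)
              (rA : regs τ 5 ≡ A) (rC : regs τ 6 ≡ C) where

    gain : ℕ → ℕ
    gain k = V τ A k + V τ k C + w k

    -- An argument `k` that is not below `n` means that no task has been recorded; `v` is then the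
    -- profit of the empty set. All gains refer to `τ`, as the search writes no array.
    record Best (j v k : ℕ) : Set where
      field
        some : k < n → Fits A C k × v ≡ gain k
        none : ¬ k < n → v ≡ 0
        max  : ∀ {i} → i < j → Fits A C i → gain i ≤ v

    τ₀ τ₁ τ₂ : State
    τ₀ = setReg 9 (regs τ 0) (setReg 8 0 τ)
    τ₁ = run search τ₀
    τ₂ = setArr 12 (⟦ pair 5 6 ⟧ τ₁) (regs τ₁ 8) τ₁

    module Visit (j : ℕ) (ρ : State) (j<r0 : j < regs τ 0) (r7 : regs ρ 7 ≡ j) (fr : Frame search τ₀ ρ) where

      ρ-static : Static ρ
      ρ-static = static-frame search refl refl refl (λ _ _ → refl) fr st

      j<n : j < n
      j<n = subst (j <_) (proj₁ (proj₁ st)) j<r0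

      r5 : regs ρ 5 ≡ A
      r5 = trans (sameReg fr 5 refl) rA

      r6 : regs ρ 6 ≡ C
      r6 = trans (sameReg fr 6 refl) rC

      candidate-value : ⟦ candidate ⟧ ρ ≡ gain j
      candidate-value
        rewrite pair-value {ρ} {5} {7} ρ-static r5 r7 A≤n (<⇒≤ j<n)
              | pair-value {ρ} {7} {6} ρ-static r7 r6 (<⇒≤ j<n) C≤n
              | sameArr fr 12 refl | proj₂ ρ-static 4 refl | r7 = refl

      fits-at : Fits (regs ρ 5) (regs ρ 6) (regs ρ 7) ≡ Fits A C j
      fits-at rewrite r5 | r6 | r7 = refl

    found : Best n (regs τ₁ 8) (regs τ₁ 9)
    found = subst (λ j → Best j (regs τ₁ 8) (regs τ₁ 9)) (proj₁ (proj₁ st))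
      (for-rule 7 0 _ τ₀ _ (λ j ρ → Best j (regs ρ 8) (regs ρ 9)) base next)
      where
      base : Best 0 0 (regs τ 0)
      base = record
        { some = λ r0<n → contradiction r0<n (<-irrefl (proj₁ (proj₁ st)))
        ; none = λ _ → refl
        ; max  = λ () }

      next : ∀ j ρ → j < regs τ 0 → regs ρ 7 ≡ j → Frame search τ₀ ρ → Best j (regs ρ 8) (regs ρ 9) →
             Best (suc j)
               (regs (run searchStep ρ) 8)
               (regs (run searchStep ρ) 9)
      next j ρ j<r0 r7 fr best with ⟦ fitsTest and reg 8 ≺ candidate ⟧ᵗ ρ in eq
      ... | true = record
        { some = λ _ → subst (Fits A C) (sym r7) fit , trans candidate-value (cong gain (sym r7))
        ; none = λ ≮n → contradiction (subst (_< n) (sym r7) j<n) ≮n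
        ; max  = λ i<1+j → max (m<1+n⇒m<n∨m≡n i<1+j)
        }
        where
        open Visit j ρ j<r0 r7 fr
        both : T (⟦ fitsTest ⟧ᵗ ρ) × T (regs ρ 8 <ᵇ ⟦ candidate ⟧ ρ)
        both = ∧-T {⟦ fitsTest ⟧ᵗ ρ} (Equivalence.from T-≡ eq)
        fit : Fits A C j
        fit = subst (λ P → P) fits-at (test-sound ρ ρ-static (proj₁ both))
        max : ∀ {i} → i < j ⊎ i ≡ j → Fits A C i → gain i ≤ ⟦ candidate ⟧ ρ
        max (inj₁ i<j) F = ≤-trans (Best.max best i<j F) (<⇒≤ (<ᵇ⇒< (regs ρ 8) (⟦ candidate ⟧ ρ) (proj₂ both)))
        max (inj₂ refl) F = ≤-reflexive (sym candidate-value)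
      ... | false = record
        { some = Best.some best
        ; none = Best.none best
        ; max  = λ i<1+j → max (m<1+n⇒m<n∨m≡n i<1+j)
        }
        where
        open Visit j ρ j<r0 r7 fr
        max : ∀ {i} → i < j ⊎ i ≡ j → Fits A C i → gain i ≤ regs ρ 8
        max (inj₁ i<j) F = Best.max best i<j F
        max (inj₂ refl) F = ≮⇒≥ λ better → contradiction
          (trans (sym eq) (Equivalence.to T-≡ (Equivalence.from (T-∧ {⟦ fitsTest ⟧ᵗ ρ})
            ( test-complete ρ ρ-static (subst (λ P → P) (sym fits-at) F)
            , <⇒<ᵇ (subst (regs ρ 8 <_) (sym candidate-value) better)))))
          λ ()

    k* : ℕ
    k* = regs τ₁ 9

    τ₁-static : Static τ₁
    τ₁-static = static-frame search refl refl refl (λ _ _ → refl) (frame-run search τ₀) st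

    pair-τ₁ : ⟦ pair 5 6 ⟧ τ₁ ≡ address n A C
    pair-τ₁ = pair-value {τ₁} {5} {6} τ₁-static
      (trans (regs-run search {5} τ₀ refl) rA) (trans (regs-run search {6} τ₀ refl) rC) A≤n C≤n

    τ₂-static : Static τ₂
    τ₂-static = proj₁ τ₁-static , λ B wr →
      trans (update-false (arrs τ₁) 12 _ B (proj₁ (∨-false {B ≡ᵇ 12} (proj₁ (∨-false {writesArr sweeps B} wr))))) (proj₂ τ₁-static B wr)

    solution : ℕ → ℕ
    solution i with k* <? n
    ... | yes _ = S τ A k* i + S τ k* C i + δ k* i
    ... | no  _ = 0

    -- The block of the pair is overwritten while two other blocks are being read; `other`
    -- guarantees that those still have their contents from `τ`.
    record Copied (j : ℕ) (ρ : State) : Set where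
      field
        done  : ∀ {i} → i < j → S ρ A C i ≡ solution i
        other : ∀ {A′ C′} → C′ ≤ n → A′ ≢ A ⊎ C′ ≢ C → ∀ {i} → i < n → S ρ A′ C′ i ≡ S τ A′ C′ i

    τ₃ : State
    τ₃ = run copy τ₂

    copied : Copied n τ₃
    copied = subst (λ j → Copied j τ₃) (proj₁ (proj₁ τ₂-static))
      (for-rule 7 0 _ τ₂ _ Copied base next)
      where
      base : Copied 0 (setReg 7 0 τ₂)
      base = record
        { done = λ ()
        ; other = λ {A′} {C′} _ _ {i} _ →
            cong (λ f → f (address n A′ C′ + i)) (arrs-run search {13} τ₀ refl) }

      next : ∀ j ρ → j < regs τ₂ 0 → regs ρ 7 ≡ j → Frame copy τ₂ ρ → Copied j ρ →
             Copied (suc j) (setReg 7 (suc j) (run copyStep ρ))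
      next j ρ j<r0 r7 fr cp = subst (λ π → Copied (suc j) (setReg 7 (suc j) π)) (sym stored) record
        { done = λ i<1+j → done (m<1+n⇒m<n∨m≡n i<1+j)
        ; other = λ C′≤n diff i<n → trans (update-≢ (arrs ρ 13) (solution j)
            (λ e → absurd diff (address-injective n C′≤n C≤n (<⇒≤ i<n) (<⇒≤ j<n) e)))
            (Copied.other cp C′≤n diff i<n) }
        where
        j<n : j < n
        j<n = subst (j <_) (proj₁ (proj₁ τ₂-static)) j<r0

        ρ-static : Static ρ
        ρ-static = static-frame copy refl refl refl
          (λ B wr → proj₂ (∨-false {B ≡ᵇ 12} (proj₁ (∨-false {writesArr sweeps B} wr)))) fr τ₂-static

        r5 : regs ρ 5 ≡ A
        r5 = trans (sameReg fr 5 refl) (trans (regs-run search {5} τ₀ refl) rA)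

        r6 : regs ρ 6 ≡ C
        r6 = trans (sameReg fr 6 refl) (trans (regs-run search {6} τ₀ refl) rC)

        r9 : regs ρ 9 ≡ k*
        r9 = sameReg fr 9 refl

        absurd : ∀ {A′ C′ i} {P : Set} → A′ ≢ A ⊎ C′ ≢ C → A′ ≡ A × C′ ≡ C × i ≡ j → P
        absurd (inj₁ A≢) (A≡ , _)     = contradiction A≡ A≢
        absurd (inj₂ C≢) (_ , C≡ , _) = contradiction C≡ C≢

        index : ⟦ pair 5 6 ⊕ reg 7 ⟧ ρ ≡ address n A C + j
        index = cong₂ _+_ (pair-value {ρ} {5} {6} ρ-static r5 r6 A≤n C≤n) r7

        F : k* < n → Fits A C k*
        F k<n = proj₁ (Best.some found k<n)

        union-value : k* < n → ⟦ union ⟧ ρ ≡ S τ A k* j + S τ k* C j + δ k* j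
        -- The blocks read differ from the block written: `k*` equals neither `A` nor `C`, since a
        -- task does not fit next to itself.
        union-value k<n
          rewrite pair-value {ρ} {5} {9} ρ-static r5 r9 A≤n (<⇒≤ k<n)
                | pair-value {ρ} {9} {6} ρ-static r9 r6 (<⇒≤ k<n) C≤n
                | r9 | r7
                | Copied.other cp {A} (<⇒≤ k<n) (inj₂ (λ k≡C → not-self-left k<n (subst (λ c → Fits A c k*) (sym k≡C) (F k<n)))) j<n
                | Copied.other cp {k*} C≤n (inj₁ (λ k≡A → not-self-right k<n (subst (λ a → Fits a C k*) (sym k≡A) (F k<n)))) j<n
                = refl

        stored : run copyStep ρ
                 ≡ setArr 13 (address n A C + j) (solution j) ρ
        stored with k* <? n
        ... | yes k<n = trans
          (run-true (reg 9 ≺ reg 0) copyUnion copyZero ρ (Equivalence.to T-≡ (<⇒<ᵇ (subst₂ _<_ (sym r9) (sym (proj₁ (proj₁ ρ-static))) k<n))))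
          (cong₂ (λ a x → setArr 13 a x ρ) index (union-value k<n))
        ... | no k≮n = trans
          (run-false (reg 9 ≺ reg 0) copyUnion copyZero ρ (≮-false (subst₂ (λ a c → ¬ a < c) (sym r9) (sym (proj₁ (proj₁ ρ-static))) k≮n)))
          (cong (λ a → setArr 13 a 0 ρ) index)
          where
          ≮-false : ∀ {a c} → ¬ a < c → (a <ᵇ c) ≡ false
          ≮-false {a} {c} a≮c with a <ᵇ c in eq
          ... | false = refl
          ... | true  = contradiction (<ᵇ⇒< a c (Equivalence.from T-≡ eq)) a≮c

        done : ∀ {i} → i < j ⊎ i ≡ j → update (arrs ρ 13) (address n A C + j) (solution j) (address n A C + i) ≡ solution i
        done (inj₁ i<j)  = trans
          (update-≢ (arrs ρ 13) (solution j) (λ e → <⇒≢ i<j (+-cancelˡ-≡ (address n A C) _ _ e)))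
          (Copied.done cp i<j)
        done (inj₂ refl) = update-≡ (arrs ρ 13) (address n A C + j) (solution j)

    value-τ₃ : ∀ A′ C′ → V τ₃ A′ C′ ≡ update (arrs τ 12) (address n A C) (regs τ₁ 8) (address n A′ C′)
    value-τ₃ A′ C′ = trans (cong (λ f → f (address n A′ C′)) (arrs-run copy {12} τ₂ refl))
      (cong₂ (λ a f → update f a (regs τ₁ 8) (address n A′ C′)) pair-τ₁ (arrs-run search {12} τ₀ refl))

    solvePair-solves : (∀ {k} → k < n → Fits A C k → Solved τ A k × Solved τ k C) → Solved τ₃ A C
    solvePair-solves sub = optimal-cong
      (sym (trans (value-τ₃ A C) (update-≡ (arrs τ 12) (address n A C) (regs τ₁ 8))))
      (λ i i<n → sym (Copied.done copied i<n))
      optimal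
      where
      optimal : Optimal A C (regs τ₁ 8) solution
      optimal with k* <? n | Best.some found | Best.none found
      ... | yes k<n | some | _ = optimal-cong refl (λ _ _ → refl)
        (optimal-via (V τ) (S τ) (Best.max found) sub k<n (proj₁ (some k<n)) (proj₂ (some k<n)))
      ... | no k≮n | _ | none = optimal-cong refl (λ _ _ → refl)
        (optimal-none (V τ) (S τ) (Best.max found) sub (none k≮n) {λ _ → 0} (λ _ _ → refl))

    solvePair-keeps : ∀ {A′ C′} → C′ ≤ n → A′ ≢ A ⊎ C′ ≢ C → Solved τ A′ C′ → Solved τ₃ A′ C′
    solvePair-keeps {A′} {C′} C′≤n diff = optimal-cong
      (sym (trans (value-τ₃ A′ C′) (update-≢ (arrs τ 12) (regs τ₁ 8) (λ e → apart diff e))))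
      (λ i i<n → sym (Copied.other copied C′≤n diff i<n))
      where
      apart : A′ ≢ A ⊎ C′ ≢ C → address n A′ C′ ≢ address n A C
      apart diff e with A≡ , C≡ , _ ← address-injective n {A′} {C′} {0} {A} {C} {0} C′≤n C≤n z≤n z≤n (cong (_+ 0) e) with diff
      ... | inj₁ A≢ = A≢ A≡
      ... | inj₂ C≢ = C≢ C≡

  Progress : (ℕ → ℕ → Set) → State → Set
  Progress D τ = Static τ × (∀ {A C} → A ≤ n → C ≤ n → D A C → Solved τ A C)

  progress-map : ∀ {D D′ : ℕ → ℕ → Set} τ → (∀ {A C} → A ≤ n → C ≤ n → D′ A C → D A C) →
                 Progress D τ → Progress D′ τ
  progress-map τ f (st , p) = st , λ A≤n C≤n d → p A≤n C≤n (f A≤n C≤n d)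

  -- `D` describes the pairs known to be solved. The visited pair may already belong to `D`, and
  -- then it is solved afresh, which is certain to succeed only for span at most `r`; hence the
  -- bound in the first alternative too.
  solvePair-progress : ∀ {D r A C} τ → (∀ {A′ C′} → span A′ C′ < r → D A′ C′) →
                       A ≤ n → C ≤ n → regs τ 5 ≡ A → regs τ 6 ≡ C → Progress D τ →
                       Progress (λ A′ C′ → span A′ C′ ≤ r × D A′ C′ ⊎ span A′ C′ ≤ r × A′ ≡ A × C′ ≡ C)
                                (run solvePair τ)
  solvePair-progress {D} {r} {A} {C} τ short A≤n C≤n rA rC (st , p) = static , solved
    where
    open Pair τ st A C A≤n C≤n rA rC

    static : Static τ₃
    static = static-frame solvePair {τ} {τ₃} refl refl refl
      (λ B wr → proj₁ (∨-false {writesArr sweeps B} wr)) (frame-run solvePair τ) st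

    here : span A C ≤ r → Solved τ₃ A C
    here sp = solvePair-solves λ {k} k<n F →
      p A≤n (<⇒≤ k<n) (short (<-≤-trans (span-left k<n F) sp)) ,
      p (<⇒≤ k<n) C≤n (short (<-≤-trans (span-right k<n F) sp))

    solved : ∀ {A′ C′} → A′ ≤ n → C′ ≤ n →
             span A′ C′ ≤ r × D A′ C′ ⊎ span A′ C′ ≤ r × A′ ≡ A × C′ ≡ C → Solved τ₃ A′ C′
    solved _ _ (inj₂ (sp , refl , refl)) = here sp
    solved {A′} {C′} A′≤n C′≤n (inj₁ (sp , d)) with A′ ≟ A | C′ ≟ C
    ... | yes refl | yes refl = here sp
    ... | no A≢    | _        = solvePair-keeps C′≤n (inj₁ A≢) (p A′≤n C′≤n d)
    ... | _        | no C≢    = solvePair-keeps C′≤n (inj₂ C≢) (p A′≤n C′≤n d)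

  -- The state within the sweep for span `r`: all shorter pairs are solved, and so are the pairs of
  -- span `r` that precede position `(a , c)` lexicographically.
  RowDone : ℕ → ℕ → ℕ → ℕ → ℕ → Set
  RowDone r a c A C = span A C < r ⊎ (span A C ≤ r × (A < a ⊎ (A ≡ a × C < c)))

  row-progress : ∀ {r a} τ → a ≤ n → regs τ 5 ≡ a → Progress (RowDone r a 0) τ →
                 Progress (RowDone r (suc a) 0) (run row τ)
  row-progress {r} {a} τ a≤n r5 pr = progress-map {RowDone r a (suc n)} (run row τ) finish
    (subst (λ c → Progress (RowDone r a c) (run row τ)) (proj₁ (proj₂ (proj₁ (proj₁ pr))))
      (for-rule 6 2 solvePair τ _ (λ c → Progress (RowDone r a c)) pr next))
    where
    finish : ∀ {A C} → A ≤ n → C ≤ n → RowDone r (suc a) 0 A C → RowDone r a (suc n) A C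
    finish _ _ (inj₁ sp) = inj₁ sp
    finish _ C≤n (inj₂ (sp , inj₁ A<1+a)) with m<1+n⇒m<n∨m≡n A<1+a
    ... | inj₁ A<a = inj₂ (sp , inj₁ A<a)
    ... | inj₂ A≡a = inj₂ (sp , inj₂ (A≡a , s≤s C≤n))

    next : ∀ c ρ → c < regs τ 2 → regs ρ 6 ≡ c → Frame row τ ρ → Progress (RowDone r a c) ρ →
           Progress (RowDone r a (suc c)) (setReg 6 (suc c) (run solvePair ρ))
    next c ρ c<r2 r6 fr prρ = progress-map
      {λ A C → span A C ≤ r × RowDone r a c A C ⊎ span A C ≤ r × A ≡ a × C ≡ c}
      (run solvePair ρ) (λ _ _ → split-off)
      (solvePair-progress ρ inj₁ a≤n c≤n (trans (sameReg fr 5 refl) r5) r6 prρ)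
      where
      c≤n : c ≤ n
      c≤n = ≤-pred (subst (c <_) (proj₁ (proj₂ (proj₁ (proj₁ pr)))) c<r2)
      split-off : ∀ {A C} → RowDone r a (suc c) A C →
                  span A C ≤ r × RowDone r a c A C ⊎ span A C ≤ r × A ≡ a × C ≡ c
      split-off (inj₁ sp) = inj₁ (<⇒≤ sp , inj₁ sp)
      split-off (inj₂ (sp , inj₁ A<a)) = inj₁ (sp , inj₂ (sp , inj₁ A<a))
      split-off (inj₂ (sp , inj₂ (A≡a , C<1+c))) with m<1+n⇒m<n∨m≡n C<1+c
      ... | inj₁ C<c = inj₁ (sp , inj₂ (sp , inj₂ (A≡a , C<c)))
      ... | inj₂ C≡c = inj₂ (sp , A≡a , C≡c)

  sweep-progress : ∀ {r} τ → Progress (λ A C → span A C < r) τ →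
                   Progress (λ A C → span A C < suc r) (run sweep τ)
  sweep-progress {r} τ pr = progress-map {RowDone r (suc n) 0} (run sweep τ)
    (λ A≤n _ sp → inj₂ (≤-pred sp , inj₁ (s≤s A≤n)))
    (subst (λ a → Progress (RowDone r a 0) (run sweep τ)) (proj₁ (proj₂ (proj₁ (proj₁ pr))))
      (for-rule 5 2 row τ _ (λ a → Progress (RowDone r a 0))
        (progress-map {λ A C → span A C < r} τ (λ _ _ → start) pr) next))
    where
    start : ∀ {A C} → RowDone r 0 0 A C → span A C < r
    start (inj₁ sp)                  = sp
    start (inj₂ (_ , inj₁ ()))
    start (inj₂ (_ , inj₂ (_ , ())))

    next : ∀ a ρ → a < regs τ 2 → regs ρ 5 ≡ a → Frame sweep τ ρ → Progress (RowDone r a 0) ρ →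
           Progress (RowDone r (suc a) 0) (setReg 5 (suc a) (run row ρ))
    next a ρ a<r2 r5 _ = row-progress ρ (≤-pred (subst (a <_) (proj₁ (proj₂ (proj₁ (proj₁ pr)))) a<r2)) r5

  -- Before the first sweep the claim concerns spans below 0 and is empty, so nothing is assumed
  -- about the initial values and solutions.
  sweeps-progress : Static σ₀ → Progress (λ A C → span A C < rounds) (run sweeps σ₀)
  sweeps-progress st = subst (λ r → Progress (λ A C → span A C < r) (run sweeps σ₀)) (proj₂ (proj₂ (proj₁ st)))
    (for-rule 4 3 sweep σ₀ _ (λ r → Progress (λ A C → span A C < r))
      (st , λ _ _ ()) (λ r ρ _ _ _ → sweep-progress ρ))

  extracted : ∀ τ → Static τ → ∀ {i} → i < n → arrs (run extract τ) 5 i ≡ S τ n n i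
  extracted τ st = subst (λ j → ∀ {i} → i < j → arrs (run extract τ) 5 i ≡ S τ n n i) (proj₁ (proj₁ st))
    (for-rule 7 0 (5 [ reg 7 ]← 13 ‼ (pair 0 0 ⊕ reg 7)) τ _
      (λ j ρ → ∀ {i} → i < j → arrs ρ 5 i ≡ S τ n n i) (λ ()) next)
    where
    next : ∀ j ρ → j < regs τ 0 → regs ρ 7 ≡ j → Frame extract τ ρ →
           (∀ {i} → i < j → arrs ρ 5 i ≡ S τ n n i) →
           ∀ {i} → i < suc j →
           update (arrs ρ 5) (regs ρ 7) (arrs ρ 13 (⟦ pair 0 0 ⟧ ρ + regs ρ 7)) i ≡ S τ n n i
    next j ρ _ r7 fr inv {i} i<1+j with m<1+n⇒m<n∨m≡n i<1+j
    ... | inj₁ i<j = trans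
      (update-≢ (arrs ρ 5) (arrs ρ 13 (⟦ pair 0 0 ⟧ ρ + regs ρ 7)) (λ i≡r7 → <⇒≢ i<j (trans i≡r7 r7)))
      (inv i<j)
    ... | inj₂ refl rewrite r7 = trans
      (update-≡ (arrs ρ 5) j (arrs ρ 13 (⟦ pair 0 0 ⟧ ρ + j)))
      (cong₂ (λ f a → f (a + j)) (sameArr fr 13 refl)
        (pair-value {ρ} {0} {0} ρ-static (proj₁ (proj₁ ρ-static)) (proj₁ (proj₁ ρ-static)) ≤-refl ≤-refl))
      where
      ρ-static : Static ρ
      ρ-static = static-frame extract refl refl refl (λ B wr → proj₂ (∨-false {writesArr sweeps B} wr)) fr st

-- Bottleneck edges and address tables

table-fills : ∀ B e τ v → (∀ ρ → Frame (table B e) τ ρ → ⟦ e ⟧ ρ ≡ v) → arrs τ B 0 ≡ 0 →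
              ∀ {i} → i ≤ regs τ 2 → arrs (run (table B e) τ) B i ≡ i * v
table-fills B e τ v e-value start = for-rule 4 2 (B [ reg 4 ⊕ lit 1 ]← B at 4 ⊕ e) τ _
  (λ j ρ → ∀ {i} → i ≤ j → arrs ρ B i ≡ i * v) (λ { z≤n → start }) next
  where
  next : ∀ j ρ → j < regs τ 2 → regs ρ 4 ≡ j → Frame (table B e) τ ρ →
         (∀ {i} → i ≤ j → arrs ρ B i ≡ i * v) → ∀ {i} → i ≤ suc j →
         arrs (run (B [ reg 4 ⊕ lit 1 ]← B at 4 ⊕ e) ρ) B i ≡ i * v
  next j ρ _ refl fr inv {i} i≤1+j
    rewrite update-≡ (arrs ρ) B (update (arrs ρ B) (j + 1) (arrs ρ B j + ⟦ e ⟧ ρ)) | +-comm j 1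
    with m≤n⇒m<n∨m≡n i≤1+j
  ... | inj₁ i<1+j = trans (update-≢ (arrs ρ B) _ (<⇒≢ i<1+j)) (inv (≤-pred i<1+j))
  ... | inj₂ refl  = trans (update-≡ (arrs ρ B) (suc j) _)
    (trans (cong₂ _+_ (inv ≤-refl) (e-value ρ fr)) (+-comm (j * v) v))

-- A partial minimum: `v` is the capacity of an edge `e` of task `i` and is least among the edges of
-- `i` below `j`, those scanned so far.
record Bottleneck (σ : State) (i j v e : ℕ) : Set where
  field
    from  : arrs σ 1 i ≤ e
    to    : e < arrs σ 2 i
    here  : v ≡ arrs σ 0 e
    least : ∀ {x} → x < j → arrs σ 1 i ≤ x → x < arrs σ 2 i → v ≤ arrs σ 0 x

record Entry (σ : State) (i b ℓ last first : ℕ) : Set where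
  constructor entry
  field
    scan   : Bottleneck σ i (regs σ 1) b last
    ℓ≡     : ℓ ≡ b ∸ arrs σ 3 i
    first≡ : first ≡ suc last

-- All that the correctness proof learns about the preparation; there `τ` remains abstract.
record Prepared (σ τ : State) : Set where
  field
    limit : ∀ x → writesReg prepare x ≡ false → regs τ x ≡ regs σ x
    same  : ∀ A → writesArr prepare A ≡ false → arrs τ A ≡ arrs σ A
    cols  : ∀ {C} → C ≤ regs σ 2 → arrs τ 11 C ≡ C * regs σ 2
    rows  : ∀ {A} → A ≤ regs σ 2 → arrs τ 10 A ≡ A * (regs σ 2 * regs σ 2)
    entry-at : ∀ {i} → i < regs σ 0 → Entry σ i (arrs τ 6 i) (arrs τ 7 i) (arrs τ 8 i) (arrs τ 9 i)
    sentinel-b     : arrs τ 6 (regs σ 0) ≡ 0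
    sentinel-ℓ     : arrs τ 7 (regs σ 0) ≡ 0
    sentinel-last  : arrs τ 8 (regs σ 0) ≡ regs σ 1
    sentinel-first : arrs τ 9 (regs σ 0) ≡ 0

module Preparation (σ : State)
  (s<t : ∀ {i} → i < regs σ 0 → arrs σ 1 i < arrs σ 2 i)
  (fresh : ∀ B {i} → T (5 <ᵇ B) → arrs σ B i ≡ 0)
  where

  n m : ℕ
  n = regs σ 0
  m = regs σ 1

  u s t d : ℕ → ℕ
  u = arrs σ 0
  s = arrs σ 1
  t = arrs σ 2
  d = arrs σ 3

  scanned : ∀ i τ → i < n → regs τ 1 ≡ m → regs τ 4 ≡ i → arrs τ 0 ≡ u → arrs τ 1 ≡ s → arrs τ 2 ≡ t →
            regs τ 9 ≡ s i → regs τ 8 ≡ u (s i) →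
            Bottleneck σ i m (regs (run scanEdges τ) 8) (regs (run scanEdges τ) 9)
  scanned i τ i<n r1 r4 a0 a1 a2 r9 r8 = subst (λ j → Bottleneck σ i j (regs (run scanEdges τ) 8) (regs (run scanEdges τ) 9)) r1
    (for-rule 5 1 scanStep τ _ (λ j ρ → Bottleneck σ i j (regs ρ 8) (regs ρ 9)) base next)
    where
    base : Bottleneck σ i 0 (regs τ 8) (regs τ 9)
    base = record
      { from = ≤-reflexive (sym r9) ; to = subst (_< t i) (sym r9) (s<t i<n)
      ; here = trans r8 (cong u (sym r9)) ; least = λ () }

    next : ∀ j ρ → j < regs τ 1 → regs ρ 5 ≡ j → Frame scanEdges τ ρ → Bottleneck σ i j (regs ρ 8) (regs ρ 9) →
           Bottleneck σ i (suc j) (regs (run scanStep ρ) 8) (regs (run scanStep ρ) 9)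
    next j ρ _ r5 fr bn with ⟦ scanTest ⟧ᵗ ρ in eq
    ... | true rewrite r5 | sameReg fr 4 refl | r4 | sameArr fr 0 refl | a0 | sameArr fr 1 refl | a1 | sameArr fr 2 refl | a2
      with p , q ← ∧-T {notᵇ (j <ᵇ s i)} (Equivalence.from T-≡ eq) with q , r ← ∧-T {j <ᵇ t i} q = record
      { from  = ≼-sound (s i) j p
      ; to    = <ᵇ⇒< j (t i) q
      ; here  = refl
      ; least = λ x<1+j → least (m<1+n⇒m<n∨m≡n x<1+j)
      }
      where
      least : ∀ {x} → x < j ⊎ x ≡ j → s i ≤ x → x < t i → u j ≤ u x
      least (inj₁ x<j) s≤x x<t = ≤-trans (<⇒≤ (<ᵇ⇒< (u j) (regs ρ 8) r)) (Bottleneck.least bn x<j s≤x x<t)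
      least (inj₂ refl) _ _ = ≤-refl
    ... | false rewrite r5 | sameReg fr 4 refl | r4 | sameArr fr 0 refl | a0 | sameArr fr 1 refl | a1 | sameArr fr 2 refl | a2 = record
      { from  = Bottleneck.from bn
      ; to    = Bottleneck.to bn
      ; here  = Bottleneck.here bn
      ; least = λ x<1+j → least (m<1+n⇒m<n∨m≡n x<1+j)
      }
      where
      least : ∀ {x} → x < j ⊎ x ≡ j → s i ≤ x → x < t i → regs ρ 8 ≤ u x
      least (inj₁ x<j) s≤x x<t = Bottleneck.least bn x<j s≤x x<t
      least (inj₂ refl) s≤j j<t = ≮⇒≥ λ better → contradiction
        (trans (sym eq) (Equivalence.to T-≡ (Equivalence.from (T-∧ {notᵇ (j <ᵇ s i)})
          (≼-complete s≤j , Equivalence.from T-∧ (<⇒<ᵇ j<t , <⇒<ᵇ better)))))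
        λ ()

  -- The second half provides the sentinel: after all `n` rounds, cell `n` of arrays 6, 7 and 9
  -- still has its initial 0. Array 8 is absent because its cell `n` is set to `m` explicitly.
  Entries : ℕ → State → Set
  Entries j ρ = (∀ {i} → i < j → Entry σ i (arrs ρ 6 i) (arrs ρ 7 i) (arrs ρ 8 i) (arrs ρ 9 i)) ×
                (∀ {i} → j ≤ i → arrs ρ 6 i ≡ 0 × arrs ρ 7 i ≡ 0 × arrs ρ 9 i ≡ 0)

  σ₁ : State
  σ₁ = run bottlenecks σ

  entries : Entries n σ₁
  entries = for-rule 4 0 bottleneckStep σ _ Entries
    ((λ ()) , λ _ → fresh 6 _ , fresh 7 _ , fresh 9 _) next
    where
    next : ∀ j ρ → j < n → regs ρ 4 ≡ j → Frame bottlenecks σ ρ → Entries j ρ →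
           Entries (suc j) (setReg 4 (suc j) (run bottleneckStep ρ))
    next j ρ j<n r4 fr (old , rest) = (λ i<1+j → new (m<1+n⇒m<n∨m≡n i<1+j)) , rest′
      where
      τ₀ τ : State
      τ₀ = setReg 8 (arrs ρ 0 (arrs ρ 1 (regs ρ 4))) (setReg 9 (arrs ρ 1 (regs ρ 4)) ρ)
      τ  = run scanEdges τ₀

      r4′ : regs τ 4 ≡ j
      r4′ = trans (regs-run scanEdges {4} τ₀ refl) r4

      bn : Bottleneck σ j m (regs τ 8) (regs τ 9)
      bn = scanned j τ₀ j<n (sameReg fr 1 refl) r4 (sameArr fr 0 refl) (sameArr fr 1 refl) (sameArr fr 2 refl)
        (cong₂ (λ f k → f k) (sameArr fr 1 refl) r4)
        (cong₂ (λ f k → f k) (sameArr fr 0 refl) (cong₂ (λ f k → f k) (sameArr fr 1 refl) r4))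

      untouched : ∀ {A i x} → writesArr scanEdges A ≡ false → i ≢ j →
                  update (arrs τ A) (regs τ 4) x i ≡ arrs ρ A i
      untouched {A} {i} {x} wr i≢j = trans
        (update-≢ (arrs τ A) x (λ i≡ → i≢j (trans i≡ r4′)))
        (cong (λ f → f i) (arrs-run scanEdges τ₀ wr))

      written : ∀ A {x} → update (arrs τ A) (regs τ 4) x j ≡ x
      written A {x} = trans (cong (λ k → update (arrs τ A) k x j) r4′) (update-≡ (arrs τ A) j x)

      new : ∀ {i} → i < j ⊎ i ≡ j → Entry σ i
              (update (arrs τ 6) (regs τ 4) (regs τ 8) i)
              (update (arrs τ 7) (regs τ 4) (regs τ 8 ∸ arrs τ 3 (regs τ 4)) i)
              (update (arrs τ 8) (regs τ 4) (regs τ 9) i)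
              (update (arrs τ 9) (regs τ 4) (regs τ 9 + 1) i)
      new {i} (inj₁ i<j)
        rewrite untouched {6} {i} {regs τ 8} refl (<⇒≢ i<j)
              | untouched {7} {i} {regs τ 8 ∸ arrs τ 3 (regs τ 4)} refl (<⇒≢ i<j)
              | untouched {8} {i} {regs τ 9} refl (<⇒≢ i<j)
              | untouched {9} {i} {regs τ 9 + 1} refl (<⇒≢ i<j) = old i<j
      new (inj₂ refl)
        rewrite written 6 {regs τ 8} | written 7 {regs τ 8 ∸ arrs τ 3 (regs τ 4)}
              | written 8 {regs τ 9} | written 9 {regs τ 9 + 1} =
        entry bn (cong (regs τ 8 ∸_) demand) (+-comm (regs τ 9) 1)
        where
        demand : arrs τ 3 (regs τ 4) ≡ d j
        demand = cong₂ (λ f k → f k) (trans (arrs-run scanEdges {3} τ₀ refl) (sameArr fr 3 refl)) r4′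

      rest′ : ∀ {i} → j < i →
              update (arrs τ 6) (regs τ 4) (regs τ 8) i ≡ 0 ×
              update (arrs τ 7) (regs τ 4) (regs τ 8 ∸ arrs τ 3 (regs τ 4)) i ≡ 0 ×
              update (arrs τ 9) (regs τ 4) (regs τ 9 + 1) i ≡ 0
      rest′ {i} j<i with r6 , r7 , r9 ← rest (<⇒≤ j<i) =
        trans (untouched {6} {i} {regs τ 8} refl (>⇒≢ j<i)) r6 ,
        trans (untouched {7} {i} {regs τ 8 ∸ arrs τ 3 (regs τ 4)} refl (>⇒≢ j<i)) r7 ,
        trans (untouched {9} {i} {regs τ 9 + 1} refl (>⇒≢ j<i)) r9

  σ₂ σ₃ σ₄ : State
  σ₂ = setArr 8 (regs σ₁ 0) (regs σ₁ 1) σ₁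
  σ₃ = run (table 11 (reg 2)) σ₂
  σ₄ = run (table 10 (11 at 2)) σ₃

  tables : Code
  tables = table 11 (reg 2) ⨟ table 10 (11 at 2)

  N : ℕ
  N = regs σ 2

  N₂ : regs σ₂ 2 ≡ N
  N₂ = regs-run bottlenecks {2} σ refl

  N₃ : regs σ₃ 2 ≡ N
  N₃ = trans (regs-run (table 11 (reg 2)) {2} σ₂ refl) N₂

  σ₃-cols : ∀ {C} → C ≤ N → arrs σ₃ 11 C ≡ C * N
  σ₃-cols C≤N = table-fills 11 (reg 2) σ₂ N (λ ρ fr → trans (sameReg fr 2 refl) N₂)
    (trans (cong (λ f → f 0) (arrs-run bottlenecks {11} σ refl)) (fresh 11 _))
    (subst (_ ≤_) (sym N₂) C≤N)

  cols : ∀ {C} → C ≤ N → arrs σ₄ 11 C ≡ C * N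
  cols {C} C≤N = trans (cong (λ f → f C) (arrs-run (table 10 (11 at 2)) {11} σ₃ refl)) (σ₃-cols C≤N)

  rows : ∀ {A} → A ≤ N → arrs σ₄ 10 A ≡ A * (N * N)
  rows A≤N = table-fills 10 (11 at 2) σ₃ (N * N)
    (λ ρ fr → trans (cong₂ (λ f k → f k) (sameArr fr 11 refl) (trans (sameReg fr 2 refl) N₃)) (σ₃-cols ≤-refl))
    (trans (cong (λ f → f 0) (arrs-run (bottlenecks ⨟ (8 [ reg 0 ]← reg 1) ⨟ table 11 (reg 2)) {10} σ refl)) (fresh 10 _))
    (subst (_ ≤_) (sym N₃) A≤N)

  sentinel-last : arrs σ₄ 8 n ≡ m
  sentinel-last = trans (cong (λ f → f n) (arrs-run tables {8} σ₂ refl))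
    (trans (cong₂ (λ k x → update (arrs σ₁ 8) k x n) (regs-run bottlenecks {0} σ refl) (regs-run bottlenecks {1} σ refl))
           (update-≡ (arrs σ₁ 8) n m))

  sentinel-b : arrs σ₄ 6 n ≡ 0
  sentinel-b = trans (cong (λ f → f n) (arrs-run tables {6} σ₂ refl)) (proj₁ (proj₂ entries ≤-refl))

  sentinel-ℓ : arrs σ₄ 7 n ≡ 0
  sentinel-ℓ = trans (cong (λ f → f n) (arrs-run tables {7} σ₂ refl)) (proj₁ (proj₂ (proj₂ entries ≤-refl)))

  sentinel-first : arrs σ₄ 9 n ≡ 0
  sentinel-first = trans (cong (λ f → f n) (arrs-run tables {9} σ₂ refl)) (proj₂ (proj₂ (proj₂ entries ≤-refl)))

  entry-at : ∀ {i} → i < n → Entry σ i (arrs σ₄ 6 i) (arrs σ₄ 7 i) (arrs σ₄ 8 i) (arrs σ₄ 9 i)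
  entry-at {i} i<n
    rewrite arrs-run tables {6} σ₂ refl | arrs-run tables {7} σ₂ refl
          | arrs-run tables {8} σ₂ refl | arrs-run tables {9} σ₂ refl
          | regs-run bottlenecks {0} σ refl
          | update-≢ (arrs σ₁ 8) {n} (regs σ₁ 1) (<⇒≢ i<n) = proj₁ entries i<n

  prepared : Prepared σ σ₄
  prepared = record
    { limit = λ x → regs-run prepare {x} σ
    ; same = λ A → arrs-run prepare {A} σ
    ; cols = cols
    ; rows = rows
    ; entry-at = entry-at
    ; sentinel-b = sentinel-b
    ; sentinel-ℓ = sentinel-ℓ
    ; sentinel-last = sentinel-last
    ; sentinel-first = sentinel-first
    }

-- Correctness and running time on UFPP instances

indicator : ∀ {P : Set} → Dec P → ℕ
indicator P? = if does P? then 1 else 0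

indicator-≡ : ∀ {P : Set} (P? : Dec P) {x} → x ≤ 1 → (P → 0 < x) → (0 < x → P) → x ≡ indicator P?
indicator-≡ (yes p) x≤1 pos _   = ≤-antisym x≤1 (pos p)
indicator-≡ (no ¬p) x≤1 _   mem = n≤0⇒n≡0 (≮⇒≥ (¬p ∘ mem))

-- Generalised from `allFin n`, the case `f = id`, because the induction passes to `f ∘ suc`.
sum-filter : ∀ {n} {A : Set} {P : A → Set} (P? : Decidable P) (w : A → ℕ) (f : Fin n → A) →
             ListAction.sum (List.map w (filter P? (List.tabulate f))) ≡ sum (λ i → indicator (P? (f i)) * w (f i))
sum-filter {zero}  P? w f = refl
sum-filter {suc n} P? w f with P? (f zero)
... | yes _ = cong₂ _+_ (sym (+-identityʳ (w (f zero)))) (sum-filter P? w (f ∘ suc))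
... | no  _ = sum-filter P? w (f ∘ suc)

fromFin-toℕ : ∀ {k} (f : Fin k → ℕ) i → fromFin f (toℕ i) ≡ f i
fromFin-toℕ {k} f i with toℕ i <? k
... | yes i<k = cong f (fromℕ<-toℕ i i<k)
... | no  i≮k = contradiction (toℕ<n i) i≮k

below : ∀ {n} (P : ℕ → Set) → (∀ (i : Fin n) → P (toℕ i)) → ∀ {k} → k < n → P k
below P p k<n = subst P (toℕ-fromℕ< k<n) (p (fromℕ< k<n))

-- Pigeonhole: `cover` assigns to each vertex one of the `n + n` slots "start of i" and "end of i",
-- and the slot determines the vertex.
vertices≤ : ∀ {m n} → UFPP m n → suc m ≤ n + n
vertices≤ {m} {n} I = injective⇒≤ {f = λ v → Fin.join n n (side v)} λ {v} {v′} eq →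
  trans (sym (back v)) (trans (cong ([ s , t ] ∘ Fin.splitAt n) eq) (back v′))
  where
  open UFPP I
  side : Fin (suc m) → Fin n ⊎ Fin n
  side v with cover v
  ... | i , inj₁ _ = inj₁ i
  ... | i , inj₂ _ = inj₂ i
  side-end : ∀ v → [ s , t ] (side v) ≡ v
  side-end v with cover v
  ... | i , inj₁ v≡s = sym v≡s
  ... | i , inj₂ v≡t = sym v≡t
  back : ∀ v → [ s , t ] (Fin.splitAt n (Fin.join n n (side v))) ≡ v
  back v = trans (cong [ s , t ] (splitAt-join n n (side v))) (side-end v)

-- Since `b` is a `min` with a default, the lower bound must also cover the default; it is the
-- capacity of the first edge, which the task uses.
bottleneck-capacity : ∀ {m n} (I : UFPP m n) i e {v} → UFPP.Uses I i e → v ≡ UFPP.u I e →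
                      (∀ x → UFPP.Uses I i x → v ≤ UFPP.u I x) → UFPP.b I i ≡ v
bottleneck-capacity {m} I i e used refl least = ≤-antisym
  (min≤v⁺ _ _ (inj₂ (Any.map⁺ (lose (∈-filter⁺ (uses? i) (∈-allFin e) used) ≤-refl))))
  (v≤min⁺ (least _ first-used)
    (All.map⁺ (All.tabulate λ {x} x∈ → least x (proj₂ (∈-filter⁻ (uses? i) {xs = allFin m} x∈)))))
  where
  open UFPP I
  first-used : Uses i (firstEdge i)
  first-used = ≤-reflexive (sym start) , subst (_< toℕ (t i)) (sym start) (s<t i)
    where
    start : toℕ (firstEdge i) ≡ toℕ (s i)
    start = toℕ-fromℕ< _

module Start {m n : ℕ} (I : UFPP m n) where
  private module I = UFPP I

  σ : State
  σ = setReg 3 (suc m) (setReg 2 (suc n) (input I))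

  fresh : ∀ B {i} → T (5 <ᵇ B) → arrs σ B i ≡ 0
  fresh (suc (suc (suc (suc (suc (suc B)))))) _ = refl

  s<t : ∀ {i} → i < n → arrs σ 1 i < arrs σ 2 i
  s<t = below (λ i → arrs σ 1 i < arrs σ 2 i) λ i →
    subst₂ _<_ (sym (fromFin-toℕ (toℕ ∘ I.s) i)) (sym (fromFin-toℕ (toℕ ∘ I.t) i)) (I.s<t i)

  1≤n : 1 ≤ n
  1≤n with I.cover zero
  ... | i , _ = ≤-trans (s≤s z≤n) (toℕ<n i)

  -- For `n + 1` the bound holds because there is at least one task, for `m` and `m + 1` because
  -- endpoints of tasks cover all vertices.
  bounded : Bounded (2 * n) σ
  bounded {0} _ = m≤m+n n (n + 0)
  bounded {1} _ = <⇒≤ (≤-trans (vertices≤ I) (≤-reflexive (cong (n +_) (sym (+-identityʳ n)))))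
  bounded {2} _ = +-mono-≤ 1≤n (≤-reflexive (sym (+-identityʳ n)))
  bounded {3} _ = ≤-trans (vertices≤ I) (≤-reflexive (cong (n +_) (sym (+-identityʳ n))))
  bounded {suc (suc (suc (suc _)))} (s≤s (s≤s (s≤s (s≤s ()))))

module Correctness {m n : ℕ} (I : UFPP m n) (τ : State) (P : Prepared (Start.σ I) τ) where
  private module I = UFPP I
  open Start I
  open Prepared P

  s t b ℓ last first : ℕ → ℕ
  s     = fromFin (toℕ ∘ I.s)
  t     = fromFin (toℕ ∘ I.t)
  b     = arrs τ 6
  ℓ     = arrs τ 7
  last  = arrs τ 8
  first = arrs τ 9

  t≤m : ∀ {i} → i < n → t i ≤ m
  t≤m = below (λ i → t i ≤ m) λ i → subst (_≤ m) (sym (fromFin-toℕ (toℕ ∘ I.t) i)) (toℕ≤pred[n] (I.t i))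

  s-kept : arrs τ 1 ≡ s
  s-kept = same 1 refl

  t-kept : arrs τ 2 ≡ t
  t-kept = same 2 refl

  w-kept : arrs τ 4 ≡ fromFin I.w
  w-kept = same 4 refl

  module Task {k} (k<n : k < n) where
    open Entry (entry-at k<n) public
    open Bottleneck scan public

  s≡ : ∀ i → arrs τ 1 (toℕ i) ≡ toℕ (I.s i)
  s≡ i = trans (cong (λ f → f (toℕ i)) s-kept) (fromFin-toℕ (toℕ ∘ I.s) i)

  t≡ : ∀ i → arrs τ 2 (toℕ i) ≡ toℕ (I.t i)
  t≡ i = trans (cong (λ f → f (toℕ i)) t-kept) (fromFin-toℕ (toℕ ∘ I.t) i)

  b≡ : ∀ i → b (toℕ i) ≡ I.b i
  b≡ i = sym (bottleneck-capacity I i e used (trans here (trans (cong (fromFin I.u) (sym e≡)) (fromFin-toℕ I.u e)))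
    λ x (s≤x , x<t) → subst (b (toℕ i) ≤_) (fromFin-toℕ I.u x)
      (least (toℕ<n x) (subst (_≤ toℕ x) (sym (fromFin-toℕ (toℕ ∘ I.s) i)) s≤x)
                       (subst (toℕ x <_) (sym (fromFin-toℕ (toℕ ∘ I.t) i)) x<t)))
    where
    open Task (toℕ<n i)
    e<m : last (toℕ i) < m
    e<m = <-≤-trans to (t≤m (toℕ<n i))
    e : Fin m
    e = fromℕ< e<m
    e≡ : toℕ e ≡ last (toℕ i)
    e≡ = toℕ-fromℕ< e<m
    used : I.Uses i e
    used = subst₂ _≤_ (fromFin-toℕ (toℕ ∘ I.s) i) (sym e≡) from ,
           subst₂ _<_ (sym e≡) (fromFin-toℕ (toℕ ∘ I.t) i) to

  ℓ≡I : ∀ i → ℓ (toℕ i) ≡ I.ℓ i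
  ℓ≡I i = trans (Task.ℓ≡ (toℕ<n i)) (cong₂ _∸_ (b≡ i) (fromFin-toℕ I.d i))

  ℓ<b : ∀ {k} → k < n → ℓ k < b k
  ℓ<b = below (λ k → ℓ k < b k) λ i → subst₂ _<_ (sym (ℓ≡I i)) (sym (b≡ i))
    (∸-monoʳ-< (I.0<d i) (I.d≤b i))

  bottleneck : ∀ {j k} → j < n → k < n → arrs τ 1 j ≤ last k → last k < arrs τ 2 j → b j ≤ b k
  bottleneck {j} {k} j<n k<n s≤ <t = ≤-trans
    (Task.least j<n (<-≤-trans (Task.to k<n) (t≤m k<n)) (subst (λ f → f j ≤ last k) s-kept s≤) (subst (λ f → last k < f j) t-kept <t))
    (≤-reflexive (sym (Task.here k<n)))

  tables : Tables n τ
  tables = record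
    { s≤last     = λ {k} k<n → subst (λ f → f k ≤ last k) (sym s-kept) (Task.from k<n)
    ; last<t     = λ {k} k<n → subst (λ f → last k < f k) (sym t-kept) (Task.to k<n)
    ; first≡     = λ k<n → Task.first≡ k<n
    ; ℓ<b        = ℓ<b
    ; bottleneck = bottleneck
    ; rows       = λ A≤n → rows (m≤n⇒m≤1+n A≤n)
    ; cols       = λ C≤n → cols (m≤n⇒m≤1+n C≤n)
    }

  open Dynamic τ n (suc m) tables

  solved : State
  solved = run sweeps τ

  progress : Progress (λ A C → span A C < suc m) solved
  progress = sweeps-progress ((limit 0 refl , limit 2 refl , limit 3 refl) , λ _ _ → refl)

  χ : ℕ → ℕ
  χ = S solved n n

  optimum : Solved solved n n
  -- The pair of the sentinel with itself has span at most `m`, which is below the number `suc m` of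
  -- sweeps.
  optimum = proj₂ progress ≤-refl ≤-refl
    (s≤s (≤-trans (m∸n≤m (last n) (first n)) (≤-reflexive sentinel-last)))

  module O = Optimal optimum
  module X = Independent O.independent

  F : Subset n
  F = output n (run dynamic τ)

  out-bit : ∀ i → arrs (run dynamic τ) 5 (toℕ i) ≡ χ (toℕ i)
  out-bit i = extracted solved (proj₁ progress) (toℕ<n i)

  ∈-output : ∀ {i} → i ∈ F → 0 < χ (toℕ i)
  ∈-output {i} i∈F = subst (0 <_) (out-bit i) (<ᵇ⇒< 0 _ (Equivalence.from T-≡
    (trans (sym (lookup∘tabulate _ i)) ([]=⇒lookup i∈F))))

  output-∈ : ∀ {i} → 0 < χ (toℕ i) → i ∈ F
  output-∈ {i} 0<χ = lookup⇒[]= i F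
    (trans (lookup∘tabulate _ i) (Equivalence.to T-≡ (<⇒<ᵇ (subst (0 <_) (sym (out-bit i)) 0<χ))))

  rectangle≡ : ∀ i → rect (arrs τ 1 (toℕ i)) (b (toℕ i)) (arrs τ 2 (toℕ i)) (ℓ (toℕ i)) ≡ rectangle I i
  rectangle≡ i rewrite s≡ i | b≡ i | t≡ i | ℓ≡I i = refl

  compat≡ : ∀ i j → Compat (toℕ i) (toℕ j) ≡ Compatible I i j
  compat≡ i j = cong₂ CompatibleRect (rectangle≡ i) (rectangle≡ j)

  profit-weight : ∀ G ψ → (∀ i → ψ (toℕ i) ≡ indicator (i ∈? G)) → profit I G ≡ weight n (arrs τ 4) ψ
  profit-weight G ψ ψ≡ = trans (sum-filter (_∈? G) I.w id)
    (sum-cong-≗ {n} λ i → cong₂ _*_ (sym (ψ≡ i))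
      (sym (trans (cong (λ f → f (toℕ i)) w-kept) (fromFin-toℕ I.w i))))

  profit-output : profit I F ≡ weight n (arrs τ 4) χ
  profit-output = profit-weight F χ λ i →
    indicator-≡ (i ∈? F) (X.bit (toℕ<n i)) ∈-output output-∈

  -- The sentinel has its top and bottom sides at height 0, so every task clears it vertically, and
  -- its bounds 0 and `m` contain the whole path.
  everything-fits : ∀ {k} → k < n → Fits n n k
  everything-fits {k} k<n = record
    { inside-left  = subst (_≤ arrs τ 1 k) (sym sentinel-first) z≤n
    ; inside-right = subst₂ (λ f x → f k ≤ x) (sym t-kept) (sym sentinel-last) (t≤m k<n)
    ; clear-left   = inj₂ (subst (_≤ ℓ k) (sym sentinel-b) z≤n)
    ; clear-right  = inj₂ (subst (_≤ ℓ k) (sym sentinel-b) z≤n)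
    ; above-left   = subst (_≤ ℓ k) (sym sentinel-ℓ) z≤n
    ; above-right  = subst (_≤ ℓ k) (sym sentinel-ℓ) z≤n
    }

  members : Subset n → ℕ → ℕ
  members G = fromFin (λ i → indicator (i ∈? G))

  ∈-members : ∀ G i → 0 < members G (toℕ i) → i ∈ G
  ∈-members G i 0< rewrite fromFin-toℕ (λ i → indicator (i ∈? G)) i with i ∈? G
  ... | yes i∈G = i∈G

  independent-members : ∀ G → IsITS I G → Independent n n (members G)
  independent-members G its = record
    { bit    = below (λ k → members G k ≤ 1) bit
    ; fitted = λ k<n _ → everything-fits k<n
    ; compat = λ {i} {j} i<n j<n → below (λ i → 0 < members G i → 0 < members G j → i ≢ j → Compat i j)
        (λ i → below (λ j → 0 < members G (toℕ i) → 0 < members G j → toℕ i ≢ j → Compat (toℕ i) j)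
          (λ j i∈ j∈ i≢j → subst id (sym (compat≡ i j))
            (its i j (∈-members G i i∈) (∈-members G j j∈) (i≢j ∘ cong toℕ))) j<n) i<n
    }
    where
    bit : ∀ i → members G (toℕ i) ≤ 1
    bit i rewrite fromFin-toℕ (λ i → indicator (i ∈? G)) i with i ∈? G
    ... | yes _ = ≤-refl
    ... | no  _ = z≤n

  maximum : IsMaximumITS I F
  maximum = (λ i j i∈F j∈F i≢j → subst id (compat≡ i j)
      (X.compat (toℕ<n i) (toℕ<n j) (∈-output i∈F) (∈-output j∈F) (i≢j ∘ toℕ-injective))) ,
    λ G its → begin
      profit I G                          ≡⟨ profit-weight G (members G) (fromFin-toℕ (λ i → indicator (i ∈? G))) ⟩
      weight n (arrs τ 4) (members G)    ≤⟨ O.upper (members G) (independent-members G its) ⟩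
      V solved n n                        ≡⟨ O.value ⟩
      weight n (arrs τ 4) χ              ≡⟨ profit-output ⟨
      profit I F                          ∎
    where open ≤-Reasoning

-- With `lit 1` as the left summand the new limits compute to `suc n` and `suc m`, so that `main`
-- starts in the state `Start.σ I` by definition.
program : Prog
program = 2 ≔ lit 1 ⊕ reg 0 ⨾ 3 ≔ lit 1 ⊕ reg 1 ⨾ compile main

-- The 8 steps are those of the two assignments before `main`, 4 each.
time-bound : ∀ {n} a k → 1 ≤ n → k ≤ a * (2 * n) ^ 4 → 8 + k ≤ (8 + a) * 2 ^ 4 * n ^ 4
time-bound {n} a k 1≤n k≤ = begin
  8 + k                                   ≤⟨ +-mono-≤ (constant (≤-trans 1≤n (m≤m+n n (n + 0))) 8 4) k≤ ⟩
  8 * (2 * n) ^ 4 + a * (2 * n) ^ 4       ≡⟨ *-distribʳ-+ ((2 * n) ^ 4) 8 a ⟨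
  (8 + a) * (2 * n) ^ 4                   ≡⟨ scale (8 + a) n ⟩
  (8 + a) * 2 ^ 4 * n ^ 4                 ∎
  where
  open ≤-Reasoning
  scale : ∀ c n → c * (2 * n) ^ 4 ≡ c * 2 ^ 4 * n ^ 4
  scale = +-*-Solver.solve 2 (λ c n → c :* (con 2 :* n) :^ 4 := c :* con 2 :^ 4 :* n :^ 4) refl
    where open +-*-Solver

-- The exponent 4 is the computed value of `degree main`: sweeps, left anchors, right anchors, and
-- within a pair the search or the copying.
run-main : ∀ {m n} (I : UFPP m n) →
           Σ[ k ∈ ℕ ] (⟨ compile main , Start.σ I ⟩⇓⟨ run main (Start.σ I) , k ⟩ × k ≤ coeff main * (2 * n) ^ 4)
run-main {n = n} I = execute (≤-trans 1≤n (m≤m+n n (n + 0))) main main-ok bounded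
  where open Start I

theorem4p18 : Σ[ p ∈ Prog ] Σ[ c ∈ ℕ ]
    (∀ {m n : ℕ} (I : UFPP m n) →
    Σ[ σ ∈ State ] Σ[ k ∈ ℕ ]
    (⟨ p , input I ⟩⇓⟨ σ , k ⟩ × k ≤ c * n ^ 4 × IsMaximumITS I (output n σ)))
theorem4p18 = program , (8 + coeff main) * 2 ^ 4 , solve
  where
  solve : ∀ {m n : ℕ} (I : UFPP m n) →
    Σ[ σ ∈ State ] Σ[ k ∈ ℕ ]
    (⟨ program , input I ⟩⇓⟨ σ , k ⟩ × k ≤ (8 + coeff main) * 2 ^ 4 * n ^ 4 × IsMaximumITS I (output n σ))
  solve {n = n} I =
    run main σ , 8 + proj₁ (run-main I) , ⇓seq ⇓reg (⇓seq ⇓reg (proj₁ (proj₂ (run-main I)))) ,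
    time-bound (coeff main) (proj₁ (run-main I)) 1≤n (proj₂ (proj₂ (run-main I))) ,
    Correctness.maximum I (run prepare σ) (Preparation.prepared σ s<t fresh)
    where open Start I
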